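{- Given an expression $E$ and a finite set $X$ of variables, it is decidable in polynomial time whether $E$ is a valid term of $RST$, whether $E$ is a valid formula of $RST$, and, if the latter holds, whether $E\succ_{RST}X$.
   Context: The terms and formulas of $RST$ (Rudimentary Set Theory), and the safety relation $\succ_{RST}$ between formulas and finite sets of variables, are defined by simultaneous recursion over the signature with the binary predicate symbols $\in$ and $=$. $Fv(\cdot)$ denotes the set of free variables of an expression; $\{x\mid\varphi\}$ and $\exists x\varphi$ bind $x$, so $Fv(\{x\mid\varphi\})=Fv(\exists x\varphi)=Fv(\varphi)\setminus\{x\}$. Terms: every variable is a term; if $x$ is a variable and $\varphi$ is a formula such that $\varphi\succ_{RST}\{x\}$, then $\{x\mid\varphi\}$ is a term. Formulas: if $t,s$ are terms then $t=s$ and $t\in s$ are (atomic) formulas; if $\varphi,\psi$ are formulas and $x$ is a variable then $\neg\varphi$, $(\varphi\wedge\psi)$, $(\varphi\vee\psi)$ and $\exists x\varphi$ are formulas. ($\to$, $\leftrightarrow$ and $\forall$ are defined classically from these.) Safety relation: $\succ_{RST}$ is the least relation such that: (1) $\varphi\succ_{RST}\emptyset$ if $\varphi$ is atomic; (2) $\varphi\succ_{RST}\{x\}$ if $\varphi$ is $x\in x$, or $\varphi$ is one of $x=t$, $t=x$, $x\in t$ where $t$ is a term with $x\notin Fv(t)$; (3) $\neg\varphi\succ_{RST}\emptyset$ if $\varphi\succ_{RST}\emptyset$; (4) $\varphi\vee\psi\succ_{RST}X$ if $\varphi\succ_{RST}X$ and $\psi\succ_{RST}X$; (5) $\varphi\wedge\psi\succ_{RST}X\cup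 Y$ if $\varphi\succ_{RST}X$, $\psi\succ_{RST}Y$ and $Y\cap Fv(\varphi)=\emptyset$; (6) $\exists y\varphi\succ_{RST}X\setminus\{y\}$ if $y\in X$ and $\varphi\succ_{RST}X$. An expression is a finite string of symbols of the language; polynomial time is with respect to the size of the input $(E,X)$. -}

module Defs where

open import Data.Bool using (Bool)
open import Data.Fin using (Fin)
open import Data.List using (List; []; _∷_; [_]; _++_; map; concatMap; filter; length)
open import Data.List.Membership.Propositional using (_∈_; _∉_)
open import Data.List.Relation.Binary.BagAndSetEquality using (_∼[_]_; set)
open import Data.List.Relation.Binary.Disjoint.Propositional using (Disjoint)
open import Data.Maybe using (Maybe; just; nothing)
open import Data.Nat using (ℕ; zero; suc; _+_; _*_; _^_)
open import Data.Nat.Binary using (ℕᵇ; zero; 2[1+_]; 1+[2_])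
open import Data.Nat.Binary.Properties using (_≟_)
open import Data.Product using (_×_; _,_; ∃-syntax)
open import Data.Sum using (_⊎_; inj₁)
open import Data.Vec as Vec using (Vec)
open import Relation.Binary.PropositionalEquality using (_≡_)
open import Relation.Nullary using (¬?)
open import Relation.Nullary.Reflects using (Reflects)

------------------------------------------------------------------------
-- Syntax of RST

-- Countably many variables v₀, v₁, v₂, …, named by their (binary) subscript.
Var : Set
Var = ℕᵇ

-- Finite sets of variables are lists; order and repetition are made
-- irrelevant by the constructor `resp` of _≻_ below.
FinSet : Set
FinSet = List Var

infixl 6 _∪_ _∖_

_∪_ : FinSet → FinSet → FinSet
_∪_ = _++_

_∖_ : FinSet → Var → FinSet
X ∖ y = filter (λ z → ¬? (z ≟ y)) X

-- Pre-terms and pre-formulas: the syntax trees obtained when {x ∣ φ} is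
-- allowed for every φ.  The terms and formulas of RST are singled out by
-- IsTerm and IsFormula, simultaneously with _≻_.

infix  9 _≐_ _∈̇_
infix  8 ¬̇_
infixr 7 _∧̇_
infixr 6 _∨̇_

data PreTerm    : Set
data PreFormula : Set

data PreTerm where
  var   : Var → PreTerm
  compr : Var → PreFormula → PreTerm

data PreFormula where
  _≐_ _∈̇_ : PreTerm → PreTerm → PreFormula
  ¬̇_      : PreFormula → PreFormula
  _∧̇_ _∨̇_ : PreFormula → PreFormula → PreFormula
  ∃̇       : Var → PreFormula → PreFormula

FvT : PreTerm → FinSet
Fv  : PreFormula → FinSet

FvT (var x)     = [ x ]
FvT (compr x φ) = Fv φ ∖ x

Fv (t ≐ s)  = FvT t ∪ FvT s
Fv (t ∈̇ s)  = FvT t ∪ FvT s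
Fv (¬̇ φ)    = Fv φ
Fv (φ ∧̇ ψ)  = Fv φ ∪ Fv ψ
Fv (φ ∨̇ ψ)  = Fv φ ∪ Fv ψ
Fv (∃̇ x φ)  = Fv φ ∖ x

infix 4 _≻_

data IsTerm    : PreTerm → Set
data IsFormula : PreFormula → Set
data _≻_       : PreFormula → FinSet → Set

data IsTerm where
  var   : ∀ x → IsTerm (var x)
  compr : ∀ {x φ} → IsFormula φ → φ ≻ [ x ] → IsTerm (compr x φ)

data IsFormula where
  eq  : ∀ {t s} → IsTerm t → IsTerm s → IsFormula (t ≐ s)
  mem : ∀ {t s} → IsTerm t → IsTerm s → IsFormula (t ∈̇ s)
  neg : ∀ {φ} → IsFormula φ → IsFormula (¬̇ φ)
  and : ∀ {φ ψ} → IsFormula φ → IsFormula ψ → IsFormula (φ ∧̇ ψ)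
  or  : ∀ {φ ψ} → IsFormula φ → IsFormula ψ → IsFormula (φ ∨̇ ψ)
  ex  : ∀ {x φ} → IsFormula φ → IsFormula (∃̇ x φ)

-- Every clause about atomic formulas requires their terms to be terms of
-- RST, so φ ≻ X holds only for formulas φ of RST.
data _≻_ where
  atom-≐ : ∀ {t s} → IsTerm t → IsTerm s → t ≐ s ≻ []
  atom-∈ : ∀ {t s} → IsTerm t → IsTerm s → t ∈̇ s ≻ []
  self   : ∀ {x} → var x ∈̇ var x ≻ [ x ]
  eqˡ    : ∀ {x t} → IsTerm t → x ∉ FvT t → var x ≐ t ≻ [ x ]
  eqʳ    : ∀ {x t} → IsTerm t → x ∉ FvT t → t ≐ var x ≻ [ x ]
  mem    : ∀ {x t} → IsTerm t → x ∉ FvT t → var x ∈̇ t ≻ [ x ]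
  neg    : ∀ {φ} → φ ≻ [] → ¬̇ φ ≻ []
  or     : ∀ {φ ψ X} → φ ≻ X → ψ ≻ X → φ ∨̇ ψ ≻ X
  and    : ∀ {φ ψ X Y} → φ ≻ X → ψ ≻ Y → Disjoint Y (Fv φ) → φ ∧̇ ψ ≻ X ∪ Y
  ex     : ∀ {y φ X} → y ∈ X → φ ≻ X → ∃̇ y φ ≻ X ∖ y
  resp   : ∀ {φ X Y} → X ∼[ set ] Y → φ ≻ X → φ ≻ Y

------------------------------------------------------------------------
-- Expressions: finite strings of symbols of the language

data Symbol : Set where
  var                               : Var → Symbol
  `∈ `= `¬ `∧ `∨ `∃ `⟦ `∣ `⟧ `⟨ `⟩ : Symbol

Expr : Set
Expr = List Symbol

-- `⟦ and `⟧ are the braces of {x ∣ φ}; `⟨ and `⟩ are the round parentheses,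
-- written only around conjunctions and disjunctions.
writeT : PreTerm → Expr
write  : PreFormula → Expr

writeT (var x)     = [ var x ]
writeT (compr x φ) = `⟦ ∷ var x ∷ `∣ ∷ write φ ++ [ `⟧ ]

write (t ≐ s) = writeT t ++ `= ∷ writeT s
write (t ∈̇ s) = writeT t ++ `∈ ∷ writeT s
write (¬̇ φ)   = `¬ ∷ write φ
write (φ ∧̇ ψ) = `⟨ ∷ write φ ++ `∧ ∷ write ψ ++ [ `⟩ ]
write (φ ∨̇ ψ) = `⟨ ∷ write φ ++ `∨ ∷ write ψ ++ [ `⟩ ]
write (∃̇ x φ) = `∃ ∷ var x ∷ write φ

ValidTerm : Expr → Set
ValidTerm E = ∃[ t ] writeT t ≡ E × IsTerm t

ValidFormula : Expr → Set
ValidFormula E = ∃[ φ ] write φ ≡ E × IsFormula φ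

Safe : Expr → FinSet → Set
Safe E X = ∃[ φ ] write φ ≡ E × IsFormula φ × φ ≻ X

------------------------------------------------------------------------
-- Inputs (E , X) as words over a finite alphabet

-- A variable is the letter 𝕧 followed by its subscript in bijective base 2
-- (digits 𝟙 and 𝟚, least significant digit first); # separates E from X.
data Letter : Set where
  ∈ˡ =ˡ ¬ˡ ∧ˡ ∨ˡ ∃ˡ ⟦ˡ ∣ˡ ⟧ˡ ⟨ˡ ⟩ˡ : Letter
  𝕧 𝟙 𝟚 #                         : Letter

digits : ℕᵇ → List Letter
digits zero     = []
digits 2[1+ n ] = 𝟚 ∷ digits n
digits 1+[2 n ] = 𝟙 ∷ digits n

encodeVar : Var → List Letter
encodeVar x = 𝕧 ∷ digits x

encodeSymbol : Symbol → List Letter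
encodeSymbol (var x) = encodeVar x
encodeSymbol `∈ = [ ∈ˡ ]
encodeSymbol `= = [ =ˡ ]
encodeSymbol `¬ = [ ¬ˡ ]
encodeSymbol `∧ = [ ∧ˡ ]
encodeSymbol `∨ = [ ∨ˡ ]
encodeSymbol `∃ = [ ∃ˡ ]
encodeSymbol `⟦ = [ ⟦ˡ ]
encodeSymbol `∣ = [ ∣ˡ ]
encodeSymbol `⟧ = [ ⟧ˡ ]
encodeSymbol `⟨ = [ ⟨ˡ ]
encodeSymbol `⟩ = [ ⟩ˡ ]

Input : Set
Input = Expr × FinSet

encode : Input → List Letter
encode (E , X) = concatMap encodeSymbol E ++ # ∷ concatMap encodeVar X

------------------------------------------------------------------------
-- Deterministic multi-tape Turing machines

data Move : Set where
  left stay right : Move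

data Control (q : ℕ) : Set where
  state : Fin q → Control q
  halt  : Bool → Control q      -- true: accept, false: reject

-- A tape symbol is the blank (nothing), an input letter, or one of w
-- additional work symbols.
TapeSymbol : ℕ → Set
TapeSymbol w = Maybe (Letter ⊎ Fin w)

record Machine : Set where
  field
    tapes-1 states works : ℕ

  tapes : ℕ
  tapes = suc tapes-1

  Γ : Set
  Γ = TapeSymbol works

  field
    start : Control states
    δ     : Fin states → Vec Γ tapes → Control states × Vec (Γ × Move) tapes

-- Two-way infinite tapes: cells to the left of the head (nearest first),
-- the scanned cell, cells to the right; all cells not listed are blank.
record Tape (w : ℕ) : Set where
  constructor tape
  field
    before  : List (TapeSymbol w)
    scanned : TapeSymbol w
    after   : List (TapeSymbol w)

blankTape : ∀ {w} → Tape w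
blankTape = tape [] nothing []

inputTape : ∀ {w} → List Letter → Tape w
inputTape []       = blankTape
inputTape (a ∷ as) = tape [] (just (inj₁ a)) (map (λ b → just (inj₁ b)) as)

move : ∀ {w} → Move → Tape w → Tape w
move stay  t                   = t
move left  (tape []       a r) = tape [] nothing (a ∷ r)
move left  (tape (b ∷ l)  a r) = tape l b (a ∷ r)
move right (tape l a [])       = tape (a ∷ l) nothing []
move right (tape l a (b ∷ r))  = tape (a ∷ l) b r

writeMove : ∀ {w} → TapeSymbol w × Move → Tape w → Tape w
writeMove (b , m) (tape l _ r) = move m (tape l b r)

module _ (M : Machine) where
  open Machine M

  record Config : Set where
    constructor config
    field
      control : Control states
      content : Vec (Tape works) tapes

  initial : List Letter → Config
  initial w = config start (inputTape w Vec.∷ Vec.replicate tapes-1 blankTape)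

  step : Config → Config
  step c@(config (halt _) _) = c
  step (config (state s) ts) with δ s (Vec.map Tape.scanned ts)
  ... | s′ , acts = config s′ (Vec.zipWith writeMove acts ts)

  run : ℕ → Config → Config
  run zero    c = c
  run (suc n) c = run n (step c)

  -- Halting configurations are fixed by step, so this says that M halts on
  -- the word w within n steps, with answer b.
  AnswersWithin : ℕ → List Letter → Bool → Set
  AnswersWithin n w b = Config.control (run n (initial w)) ≡ halt b

PolyTimeDecidable : (Input → Set) → Set
PolyTimeDecidable P =
  ∃[ M ] ∃[ c ] ∃[ d ] ∀ (i : Input) →
    let n = length (encode i) in
    ∃[ b ] AnswersWithin M (c * n ^ d + c) (encode i) b × Reflects (P i) b

{-# OPTIONS --safe #-}

-- If φ ≻ Z then Z ⊆ Fv φ, so safety is decided top-down: φ ∧ ψ ≻ Z iff φ ≻ Z ∩ Fv φ and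
-- ψ ≻ Z ∖ Fv φ, and ∃ y φ ≻ Z iff y ∉ Z and φ ≻ Z ∪ {y}.  Every condition met on the way concerns
-- a single variable, except that x = y is not safe for {x , y}.  Hence E passes iff for each pair
-- of variables x, y it passes a test that only follows the membership of x and y in Z (from the
-- root to the leaves) and in Fv (from the leaves to the root).  Once the variables of E are
-- replaced by the two bits saying whether they equal x and y, this test is the run of a
-- deterministic pushdown automaton, which a Turing machine repeats for all pairs of names
-- occurring in the input.
module Submission where

open import Defs
open import Data.Bool using (Bool; true; false; _∧_; _∨_; not; if_then_else_)
open import Data.Bool.ListAction using (all)
open import Data.Bool.Properties using (∨-identityʳ; ∨-zeroʳ; ∨-assoc; ∧-identityʳ; ∧-zeroʳ; ∧-assoc)
open import Data.Empty using (⊥; ⊥-elim)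
open import Data.Fin using (Fin; zero; suc; splitAt; join; combine; remQuot)
open import Data.Fin.Properties using (splitAt-join; remQuot-combine)
open import Data.List using (List; []; _∷_; [_]; _++_; _ʳ++_; concatMap; drop; filterᵇ; length; map; null)
open import Data.List.Membership.Propositional using (_∈_; _∉_)
open import Data.List.Membership.Propositional.Properties using (∈-++⁺ˡ; ∈-++⁺ʳ; ∈-map⁺)
open import Data.List.Properties using (map-∘; map-++; map-ʳ++; ++-assoc; ++-identityʳ; ʳ++-ʳ++; length-++; length-ʳ++)
open import Data.List.Relation.Binary.BagAndSetEquality using (_∼[_]_; set)
open import Data.List.Relation.Binary.Disjoint.Propositional using (Disjoint)
open import Data.List.Relation.Unary.All using (All; []; _∷_)
open import Data.List.Relation.Unary.All.Properties using (++⁺)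
open import Data.List.Relation.Unary.Any using (here; there)
open import Data.Maybe as Maybe using (Maybe; just; nothing)
open import Data.Nat using (ℕ; zero; suc; _+_; _*_; _^_; _∸_; _≤_; z≤n; s≤s)
open import Data.Nat.Binary using (zero; 2[1+_]; 1+[2_])
import Data.Nat.Binary.Properties as ℕᵇ
open import Data.Nat.Properties using (≤-refl; ≤-reflexive; ≤-trans; n≤1+n; m≤n⇒m≤1+n; m≤m+n; m≤n+m; m≤m*n; m+[n∸m]≡n; +-comm; +-suc; +-identityʳ; *-identityʳ; +-mono-≤; +-monoˡ-≤; +-monoʳ-≤; *-monoʳ-≤; module ≤-Reasoning)
open import Data.Nat.Tactic.RingSolver using (solve-∀)
open import Data.Product using (_×_; _,_; ∃-syntax; proj₁; proj₂)
open import Data.Sum as Sum using (_⊎_; inj₁; inj₂)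
open import Data.Unit using (⊤; tt)
open import Data.Vec as Vec using (Vec; []; _∷_)
open import Function using (_∘_; mk⇔; Equivalence)
open import Relation.Binary.PropositionalEquality hiding ([_]; resp)
open import Relation.Nullary using (does; yes; no)
open import Relation.Nullary.Reflects using (Reflects; ofʸ; ofⁿ)

-- The obstacle is that `Z ∩ Fv φ` must be imposed on φ before φ has been read, when its free
-- variables are still unknown. Therefore the intersection is never computed: `Z` itself is handed
-- down, the demand is understood relative to `Fv φ`, and each clause is verified when the free
-- variables come back. At a conjunction this needs no guessing, since `Fv φ` has come back by the
-- time ψ is entered. The price is that inclusion in the free variables has to be tested separately
-- where it is part of the claim: the variable bound by ∃ or by a comprehension must be free in the
-- body, and X must be contained in the free variables of the whole formula. Conversely the
-- condition y ∉ Z at ∃ y φ holds by itself, because y is not free in ∃ y φ. Names of variables are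
-- unbounded and do not fit into a finite control either. The machine never stores them: the two
-- names under test are given by the positions of two heads, and each token read is compared with
-- both, digit by digit.

-- Turing machines over arbitrary finite types

-- A retraction suffices: every state and work symbol met in a run is of the form `index a`.
record Finite (A : Set) : Set where
  field
    size          : ℕ
    index         : A → Fin size
    element       : Fin size → A
    element-index : ∀ a → element (index a) ≡ a

open Finite {{...}}

instance
  finite-⊤ : Finite ⊤
  finite-⊤ = record { size = 1 ; index = λ _ → zero ; element = λ _ → tt ; element-index = λ _ → refl }

  finite-Bool : Finite Bool
  finite-Bool = record
    { size = 2
    ; index = λ { false → zero ; true → suc zero }
    ; element = λ { zero → false ; (suc zero) → true }
    ; element-index = λ { false → refl ; true → refl } }

  finite-Fin : ∀ {n} → Finite (Fin n)
  finite-Fin {n} = record { size = n ; index = λ i → i ; element = λ i → i ; element-index = λ _ → refl }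

  finite-⊎ : ∀ {A B} → {{Finite A}} → {{Finite B}} → Finite (A ⊎ B)
  finite-⊎ {A} {B} = record
    { size = size {A} + size {B}
    ; index = λ x → join (size {A}) (size {B}) (Sum.map index index x)
    ; element = λ i → Sum.map element element (splitAt (size {A}) i)
    ; element-index = λ where
        (inj₁ a) → trans (cong (Sum.map element element) (splitAt-join (size {A}) (size {B}) (inj₁ (index a))))
                         (cong inj₁ (element-index a))
        (inj₂ b) → trans (cong (Sum.map element element) (splitAt-join (size {A}) (size {B}) (inj₂ (index b))))
                         (cong inj₂ (element-index b)) }

  finite-× : ∀ {A B} → {{Finite A}} → {{Finite B}} → Finite (A × B)
  finite-× {A} {B} = record
    { size = size {A} * size {B}
    ; index = λ (a , b) → combine (index a) (index b)
    ; element = λ i → let (j , k) = remQuot (size {B}) i in element j , element k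
    ; element-index = λ (a , b) → trans
        (cong (λ (j , k) → element j , element k) (remQuot-combine (index a) (index b)))
        (cong₂ _,_ (element-index a) (element-index b)) }

-- Turing machines whose states and work symbols are the elements of arbitrary
-- finite types.  A strip lists the cells to the left of the head (nearest
-- first) and the cells from the head on.
module FiniteMachine
  (Q W : Set) {{finQ : Finite Q}} {{finW : Finite W}} (k : ℕ) (q₀ : Q)
  (δ : Q → Vec (Maybe (Letter ⊎ W)) (suc k) →
       (Q ⊎ Bool) × Vec (Maybe (Maybe (Letter ⊎ W)) × Move) (suc k))
  where

  Cell : Set
  Cell = Maybe (Letter ⊎ W)

  Strip : Set
  Strip = List Cell × List Cell

  -- The outer `nothing` leaves the scanned cell as it is, while `just nothing` writes a blank.
  Action : Set
  Action = Maybe Cell × Move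

  scan : Strip → Cell
  scan (_ , [])    = nothing
  scan (_ , a ∷ _) = a

  put : Maybe Cell → Strip → Strip
  put nothing  s       = s
  put (just a) (l , r) = l , a ∷ drop 1 r

  -- When the head leaves the listed cells to the left, the blank it stood on becomes explicit,
  -- exactly as in `move`; this is what makes `move-encStrip` an equality.
  fill : List Cell → List Cell
  fill []      = nothing ∷ []
  fill (a ∷ r) = a ∷ r

  go : Move → Strip → Strip
  go stay  s           = s
  go left  ([]    , r) = [] , nothing ∷ fill r
  go left  (b ∷ l , r) = l , b ∷ fill r
  go right (l , [])    = nothing ∷ l , []
  go right (l , a ∷ r) = a ∷ l , r

  act : Action → Strip → Strip
  act (a , m) s = go m (put a s)

  Conf : Set
  Conf = (Q ⊎ Bool) × Vec Strip (suc k)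

  next : Conf → Conf
  next (inj₂ b , ts) = inj₂ b , ts
  next (inj₁ q , ts) = let (c , as) = δ q (Vec.map scan ts) in c , Vec.zipWith act as ts

  iter : ℕ → Conf → Conf
  iter zero    c = c
  iter (suc n) c = iter n (next c)

  encCell : Cell → TapeSymbol (size {W})
  encCell = Maybe.map (Sum.map₂ index)

  decCell : TapeSymbol (size {W}) → Cell
  decCell = Maybe.map (Sum.map₂ element)

  decCell-encCell : ∀ a → decCell (encCell a) ≡ a
  decCell-encCell nothing         = refl
  decCell-encCell (just (inj₁ _)) = refl
  decCell-encCell (just (inj₂ w)) = cong (just ∘ inj₂) (element-index w)

  encControl : Q ⊎ Bool → Control (size {Q})
  encControl (inj₁ q) = state (index q)
  encControl (inj₂ b) = halt b

  encAction : TapeSymbol (size {W}) → Action → TapeSymbol (size {W}) × Move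
  encAction a (nothing , m) = a , m
  encAction a (just b  , m) = encCell b , m

  machine : Machine
  machine = record
    { tapes-1 = k
    ; states  = size {Q}
    ; works   = size {W}
    ; start   = state (index q₀)
    ; δ       = λ i as → let (c , bs) = δ (element i) (Vec.map decCell as)
                         in encControl c , Vec.zipWith encAction as bs }

  encStrip : Strip → Tape (size {W})
  encStrip (l , [])    = tape (map encCell l) nothing []
  encStrip (l , a ∷ r) = tape (map encCell l) (encCell a) (map encCell r)

  encConf : Conf → Config machine
  encConf (c , ts) = config (encControl c) (Vec.map encStrip ts)

  scanned-encStrip : ∀ s → Tape.scanned (encStrip s) ≡ encCell (scan s)
  scanned-encStrip (_ , [])    = refl
  scanned-encStrip (_ , _ ∷ _) = refl

  move-encStrip : ∀ m s → move m (encStrip s) ≡ encStrip (go m s)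
  move-encStrip stay  s               = refl
  move-encStrip left  ([]    , [])    = refl
  move-encStrip left  ([]    , _ ∷ _) = refl
  move-encStrip left  (_ ∷ _ , [])    = refl
  move-encStrip left  (_ ∷ _ , _ ∷ _) = refl
  move-encStrip right (_ , [])        = refl
  move-encStrip right (_ , _ ∷ [])    = refl
  move-encStrip right (_ , _ ∷ _ ∷ _) = refl

  writeMove-encStrip : ∀ a s →
    writeMove (encAction (Tape.scanned (encStrip s)) a) (encStrip s) ≡ encStrip (act a s)
  writeMove-encStrip (nothing , m) s@(_ , [])        = move-encStrip m s
  writeMove-encStrip (nothing , m) s@(_ , _ ∷ _)     = move-encStrip m s
  writeMove-encStrip (just b  , m) (l , [])          = move-encStrip m (l , b ∷ [])
  writeMove-encStrip (just b  , m) (l , _ ∷ r)       = move-encStrip m (l , b ∷ r)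

  scans-encStrip : ∀ {n} (ts : Vec Strip n) →
    Vec.map decCell (Vec.map Tape.scanned (Vec.map encStrip ts)) ≡ Vec.map scan ts
  scans-encStrip []       = refl
  scans-encStrip (s ∷ ts) = cong₂ _∷_
    (trans (cong decCell (scanned-encStrip s)) (decCell-encCell (scan s))) (scans-encStrip ts)

  acts-encStrip : ∀ {n} (as : Vec Action n) ts →
    Vec.zipWith writeMove (Vec.zipWith encAction (Vec.map Tape.scanned (Vec.map encStrip ts)) as)
                          (Vec.map encStrip ts)
    ≡ Vec.map encStrip (Vec.zipWith act as ts)
  acts-encStrip []       []       = refl
  acts-encStrip (a ∷ as) (s ∷ ts) = cong₂ _∷_ (writeMove-encStrip a s) (acts-encStrip as ts)

  step-encConf : ∀ c → step machine (encConf c) ≡ encConf (next c)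
  step-encConf (inj₂ b , ts) = refl
  step-encConf (inj₁ q , ts)
    rewrite element-index q | scans-encStrip ts
    = cong (config _) (acts-encStrip (proj₂ (δ q (Vec.map scan ts))) ts)

  run-encConf : ∀ n c → run machine n (encConf c) ≡ encConf (iter n c)
  run-encConf zero    c = refl
  run-encConf (suc n) c = trans (cong (run machine n) (step-encConf c)) (run-encConf n (next c))

  letter : Letter → Cell
  letter a = just (inj₁ a)

  start : List Letter → Conf
  start w = inj₁ q₀ , ([] , map letter w) ∷ Vec.replicate k ([] , [])

  initial-encConf : ∀ w → initial machine w ≡ encConf (start w)
  initial-encConf w = cong (config _) (cong₂ _∷_ (input w) (blanks k))
    where
    input : ∀ w → inputTape w ≡ encStrip ([] , map letter w)
    input []       = refl
    input (a ∷ as) = cong (tape [] (just (inj₁ a))) (map-∘ as)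
    blanks : ∀ n → Vec.replicate n blankTape ≡ Vec.map encStrip (Vec.replicate n ([] , []))
    blanks zero    = refl
    blanks (suc n) = cong (blankTape ∷_) (blanks n)

  infix 4 _⟶[_]_
  infixr 5 _▷_

  -- The time is only an upper bound, so that branches of different lengths share one statement.
  _⟶[_]_ : Conf → ℕ → Conf → Set
  c ⟶[ n ] c′ = ∃[ m ] m ≤ n × iter m c ≡ c′

  Halts : Conf → ℕ → Bool → Set
  Halts c n b = ∃[ ts ] c ⟶[ n ] (inj₂ b , ts)

  done : ∀ {c} → c ⟶[ 0 ] c
  done = 0 , z≤n , refl

  one : ∀ {c c′ n} → next c ⟶[ n ] c′ → c ⟶[ suc n ] c′
  one (m , m≤n , e) = suc m , s≤s m≤n , e

  iter-+ : ∀ m n c → iter (m + n) c ≡ iter n (iter m c)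
  iter-+ zero    n c = refl
  iter-+ (suc m) n c = iter-+ m n (next c)

  _▷_ : ∀ {a b c m n} → a ⟶[ m ] b → b ⟶[ n ] c → a ⟶[ m + n ] c
  _▷_ {a = a} (i , i≤m , refl) (j , j≤n , e) = i + j , +-mono-≤ i≤m j≤n , trans (iter-+ i j a) e

  within : ∀ {a b m n} → m ≤ n → a ⟶[ m ] b → a ⟶[ n ] b
  within m≤n (i , i≤m , e) = i , ≤-trans i≤m m≤n , e

  iter-halted : ∀ n b ts → iter n (inj₂ b , ts) ≡ (inj₂ b , ts)
  iter-halted zero    b ts = refl
  iter-halted (suc n) b ts = iter-halted n b ts

  -- The run may stop early; the machine idles for the remaining `n ∸ m` steps, because `next` fixes
  -- halted configurations.
  answers : ∀ {w n b} → Halts (start w) n b → AnswersWithin machine n w b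
  answers {w} {n} {b} (ts , m , m≤n , e) = cong Config.control (begin
    run machine n (initial machine w)         ≡⟨ cong (run machine n) (initial-encConf w) ⟩
    run machine n (encConf (start w))         ≡⟨ run-encConf n (start w) ⟩
    encConf (iter n (start w))                ≡⟨ cong (λ i → encConf (iter i (start w))) (m+[n∸m]≡n m≤n) ⟨
    encConf (iter (m + (n ∸ m)) (start w))    ≡⟨ cong encConf (iter-+ m (n ∸ m) (start w)) ⟩
    encConf (iter (n ∸ m) (iter m (start w))) ≡⟨ cong (encConf ∘ iter (n ∸ m)) e ⟩
    encConf (iter (n ∸ m) (inj₂ b , ts))      ≡⟨ cong encConf (iter-halted (n ∸ m) b ts) ⟩
    encConf (inj₂ b , ts)                     ∎)
    where open ≡-Reasoning

-- Pushdown automata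

Bits : Set
Bits = Bool × Bool

-- A token is a symbol, or nothing for the separator #.
Token : Set
Token = Maybe Symbol

head : Token → Letter
head nothing        = #
head (just (var _)) = 𝕧
head (just `∈)      = ∈ˡ
head (just `=)      = =ˡ
head (just `¬)      = ¬ˡ
head (just `∧)      = ∧ˡ
head (just `∨)      = ∨ˡ
head (just `∃)      = ∃ˡ
head (just `⟦)      = ⟦ˡ
head (just `∣)      = ∣ˡ
head (just `⟧)      = ⟧ˡ
head (just `⟨)      = ⟨ˡ
head (just `⟩)      = ⟩ˡ

-- Since digits zero = [], every token t is written as head t followed by the digits of name t.
name : Token → Var
name (just (var x)) = x
name _              = zero

letters : List Token → List Letter
letters []       = []
letters (t ∷ ts) = head t ∷ digits (name t) ++ letters ts

-- The set precedes the expression, unlike in `encode`: whether x and y lie in X must be known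
-- before the root of the formula is met.
tokens : Input → List Token
tokens (E , X) = map (just ∘ var) X ++ nothing ∷ map just E

isDigit : Letter → Bool
isDigit 𝟙 = true
isDigit 𝟚 = true
isDigit _ = false

isHash : Letter → Bool
isHash # = true
isHash _ = false

Digits : List Letter → Set
Digits = All (λ a → isDigit a ≡ true)

head-nondigit : ∀ t → isDigit (head t) ≡ false
head-nondigit nothing        = refl
head-nondigit (just (var _)) = refl
head-nondigit (just `∈)      = refl
head-nondigit (just `=)      = refl
head-nondigit (just `¬)      = refl
head-nondigit (just `∧)      = refl
head-nondigit (just `∨)      = refl
head-nondigit (just `∃)      = refl
head-nondigit (just `⟦)      = refl
head-nondigit (just `∣)      = refl
head-nondigit (just `⟧)      = refl
head-nondigit (just `⟨)      = refl
head-nondigit (just `⟩)      = refl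

digits-digits : ∀ x → Digits (digits x)
digits-digits zero     = []
digits-digits 2[1+ x ] = refl ∷ digits-digits x
digits-digits 1+[2 x ] = refl ∷ digits-digits x

-- A reading control consumes a token and may push a frame; a popping control consumes the top frame
-- and no token. Of a token `read` sees only the head letter and the two comparison bits, which
-- keeps the input alphabet finite.
record PDA : Set₁ where
  field
    Reading Popping Frame : Set
    {{finite-Reading}}    : Finite Reading
    {{finite-Popping}}    : Finite Popping
    {{finite-Frame}}      : Finite Frame
    opening               : Reading
    read                  : Reading → Letter → Bits → Maybe ((Reading ⊎ Popping) × Maybe Frame)
    pop                   : Popping → Frame → Maybe (Reading ⊎ Popping)
    accepting             : Reading → Bool

module Runs (A : PDA) (x y : Var) where
  open PDA A

  marks : Token → Bits
  marks t = does (name t ℕᵇ.≟ x) , does (name t ℕᵇ.≟ y)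

  push : Maybe Frame → List Frame → List Frame
  push nothing  fs = fs
  push (just f) fs = f ∷ fs

  -- Every push is paid for by a token, so the pair of remaining tokens and stack decreases
  -- lexicographically.
  accepts    : Reading ⊎ Popping → List Frame → List Token → Bool
  shift  : Maybe ((Reading ⊎ Popping) × Maybe Frame) → List Frame → List Token → Bool
  reduce : Maybe (Reading ⊎ Popping) → List Frame → List Token → Bool

  accepts (inj₁ r) fs       []       = accepting r ∧ null fs
  accepts (inj₁ r) fs       (t ∷ ts) = shift (read r (head t) (marks t)) fs ts
  accepts (inj₂ p) []       ts       = false
  accepts (inj₂ p) (f ∷ fs) ts       = reduce (pop p f) fs ts

  shift nothing        fs ts = false
  shift (just (c , f)) fs ts = accepts c (push f fs) ts

  reduce nothing  fs ts = false
  reduce (just c) fs ts = accepts c fs ts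

-- A four-tape machine running the automaton for all pairs

module Simulation (A : PDA) where
  open PDA A

  Q W : Set
  Q = Fin 13 ⊎ (Reading ⊎ Popping) ⊎ Popping ⊎ (Reading × Bits) ⊎ (Reading × Bits)
  W = Bool ⊎ Frame

  pattern mark     = inj₁ zero
  pattern skip     = inj₁ (suc zero)
  pattern copyX    = inj₁ (suc (suc zero))
  pattern rewX     = inj₁ (suc (suc (suc zero)))
  pattern copyE    = inj₁ (suc (suc (suc (suc zero))))
  pattern rewAll   = inj₁ (suc (suc (suc (suc (suc zero)))))
  pattern nextP    = inj₁ (suc (suc (suc (suc (suc (suc zero))))))
  pattern seekP    = inj₁ (suc (suc (suc (suc (suc (suc (suc zero)))))))
  pattern nextQ    = inj₁ (suc (suc (suc (suc (suc (suc (suc (suc zero))))))))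
  pattern seekQ    = inj₁ (suc (suc (suc (suc (suc (suc (suc (suc (suc zero)))))))))
  pattern rewQ     = inj₁ (suc (suc (suc (suc (suc (suc (suc (suc (suc (suc zero))))))))))
  pattern bottom   = inj₁ (suc (suc (suc (suc (suc (suc (suc (suc (suc (suc (suc zero)))))))))))
  pattern rewMain  = inj₁ (suc (suc (suc (suc (suc (suc (suc (suc (suc (suc (suc (suc zero))))))))))))
  pattern pass c   = inj₂ (inj₁ c)
  pattern popping p = inj₂ (inj₂ (inj₁ p))
  pattern cmp r e e′  = inj₂ (inj₂ (inj₂ (inj₁ (r , e , e′))))
  pattern back r e e′ = inj₂ (inj₂ (inj₂ (inj₂ (r , e , e′))))

  Cell : Set
  Cell = Maybe (Letter ⊎ W)

  Action : Set
  Action = Maybe Cell × Move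

  pattern letter a = just (inj₁ a)
  pattern ⊢        = just (inj₂ (inj₁ false))
  pattern ⊣        = just (inj₂ (inj₁ true))
  pattern frame f  = just (inj₂ (inj₂ f))

  hold goL goR : Action
  hold = nothing , stay
  goL  = nothing , left
  goR  = nothing , right

  Response : Set
  Response = (Q ⊎ Bool) × Vec Action 4

  reject accept : Response
  reject = inj₂ false , hold ∷ hold ∷ hold ∷ hold ∷ []
  accept = inj₂ true  , hold ∷ hold ∷ hold ∷ hold ∷ []

  infix 2 _▸_∣_∣_∣_
  _▸_∣_∣_∣_ : Q → Action → Action → Action → Action → Response
  q ▸ a ∣ b ∣ c ∣ d = inj₁ q , a ∷ b ∷ c ∷ d ∷ []

  digit? : Cell → Bool
  digit? (letter a) = isDigit a
  digit? _          = false

  same : Letter → Letter → Bool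
  same 𝟙 𝟙 = true
  same 𝟚 𝟚 = true
  same _ _ = false

  agree : Letter → Cell → Bool
  agree d (letter a) = same d a
  agree d _          = false

  -- After a mismatch the head stays put, so that only matched digits separate it from the head
  -- letter of its token.
  advance : Bool → Letter → Cell → Bool × Action
  advance e d b = if e ∧ agree d b then true , goR else false , hold

  retreat : Cell → Action
  retreat b = if digit? b then goL else hold

  write-copies : Q → Cell → Action → Response
  write-copies q a m = q ▸ m ∣ just a , right ∣ just a , right ∣ just a , right

  shift : Maybe ((Reading ⊎ Popping) × Maybe Frame) → Response
  shift nothing             = reject
  shift (just (c , nothing)) = pass c ▸ hold ∣ hold ∣ hold ∣ hold
  shift (just (c , just f))  = pass c ▸ just (frame f) , right ∣ hold ∣ hold ∣ hold

  reduce : Maybe (Reading ⊎ Popping) → Response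
  reduce nothing  = reject
  reduce (just c) = pass c ▸ hold ∣ hold ∣ hold ∣ hold

  -- Tape 0 holds the input E # X and then the stack; the other tapes hold
  -- ⊢ X # E ⊣, read by the automaton on tape 1, while the heads of tapes 2 and 3
  -- point to the tokens whose names are x and y.  The states up to rewAll make the copies,
  -- those from nextP to rewQ and rewMain run through the pairs, and bottom checks that the
  -- automaton has emptied its stack.
  δ : Q → Vec Cell 4 → Response
  δ mark    (s ∷ a ∷ b ∷ c ∷ []) = write-copies skip ⊢ hold
  δ skip    (letter l ∷ _) = if isHash l then (copyX ▸ goR ∣ hold ∣ hold ∣ hold)
                             else (skip ▸ goR ∣ hold ∣ hold ∣ hold)
  δ skip    (_ ∷ _) = reject
  δ copyX   (letter l ∷ _) = write-copies copyX (letter l) goR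
  δ copyX   (_ ∷ _) = write-copies rewX (letter #) goL
  δ rewX    (letter l ∷ _) = rewX ▸ goL ∣ hold ∣ hold ∣ hold
  δ rewX    (_ ∷ _) = copyE ▸ goR ∣ hold ∣ hold ∣ hold
  δ copyE   (letter l ∷ _) = if isHash l then (rewAll ▸ goR ∣ just ⊣ , stay ∣ just ⊣ , stay ∣ just ⊣ , stay)
                             else write-copies copyE (letter l) goR
  δ copyE   (_ ∷ _) = reject
  δ rewAll  (_ ∷ ⊢ ∷ _) = nextP ▸ hold ∣ hold ∣ hold ∣ hold
  δ rewAll  (_ ∷ _ ∷ _) = rewAll ▸ hold ∣ goL ∣ goL ∣ goL
  δ nextP   (_ ∷ _) = seekP ▸ hold ∣ hold ∣ goR ∣ hold
  δ seekP   (_ ∷ _ ∷ letter l ∷ _) = if isDigit l then (seekP ▸ hold ∣ hold ∣ goR ∣ hold)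
                                     else (nextQ ▸ hold ∣ hold ∣ hold ∣ hold)
  δ seekP   (_ ∷ _ ∷ _ ∷ _) = accept
  δ nextQ   (_ ∷ _) = seekQ ▸ hold ∣ hold ∣ hold ∣ goR
  δ seekQ   (_ ∷ _ ∷ _ ∷ letter l ∷ _) = if isDigit l then (seekQ ▸ hold ∣ hold ∣ hold ∣ goR)
                                         else (pass (inj₁ opening) ▸ hold ∣ goR ∣ hold ∣ hold)
  δ seekQ   (_ ∷ _ ∷ _ ∷ _ ∷ _) = rewQ ▸ hold ∣ hold ∣ hold ∣ hold
  δ rewQ    (_ ∷ _ ∷ _ ∷ ⊢ ∷ _) = nextP ▸ hold ∣ hold ∣ hold ∣ hold
  δ rewQ    (_ ∷ _ ∷ _ ∷ _ ∷ _) = rewQ ▸ hold ∣ hold ∣ hold ∣ goL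
  δ bottom  (frame f ∷ _) = reject
  -- The cell is then the separator of the input, which serves as the bottom of the stack.
  δ bottom  (_ ∷ _) = rewMain ▸ goR ∣ hold ∣ hold ∣ hold
  δ rewMain (_ ∷ ⊢ ∷ _) = nextQ ▸ hold ∣ hold ∣ hold ∣ hold
  δ rewMain (_ ∷ _ ∷ _) = rewMain ▸ hold ∣ goL ∣ hold ∣ hold
  -- The letter read is remembered in the free cell above the stack.
  δ (pass (inj₁ r)) (_ ∷ letter l ∷ _) = cmp r true true ▸ just (letter l) , stay ∣ goR ∣ goR ∣ goR
  δ (pass (inj₁ r)) (_ ∷ _ ∷ _) = if accepting r then (bottom ▸ goL ∣ hold ∣ hold ∣ hold) else reject
  δ (pass (inj₂ p)) (_ ∷ _) = popping p ▸ goL ∣ hold ∣ hold ∣ hold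
  δ (popping p) (frame f ∷ _) = reduce (pop p f)
  δ (popping p) (_ ∷ _) = reject
  -- Names agree only if they also end together, hence the test that no digit is left under the
  -- other head. Stepping left puts each of the heads 2 and 3 on its last matched digit, or on the
  -- head letter of its token if nothing was matched.
  δ (cmp r e e′) (_ ∷ letter d ∷ b ∷ c ∷ []) =
    if isDigit d
    then (let (f , m) = advance e d b ; (f′ , m′) = advance e′ d c in cmp r f f′ ▸ hold ∣ goR ∣ m ∣ m′)
    else (back r (e ∧ not (digit? b)) (e′ ∧ not (digit? c)) ▸ hold ∣ hold ∣ goL ∣ goL)
  δ (cmp r e e′) (_ ∷ _ ∷ b ∷ c ∷ []) =
    back r (e ∧ not (digit? b)) (e′ ∧ not (digit? c)) ▸ hold ∣ hold ∣ goL ∣ goL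
  δ (back r e e′) (s ∷ _ ∷ b ∷ c ∷ []) =
    if digit? b ∨ digit? c then (back r e e′ ▸ hold ∣ hold ∣ retreat b ∣ retreat c) else recall s
    where
    recall : Cell → Response
    recall (letter l) = shift (read r l (e , e′))
    recall _          = reject

  open FiniteMachine Q W 3 mark δ hiding (Cell; Action; letter) public

  conf : Q → Strip → Strip → Strip → Strip → Conf
  conf q s a b c = inj₁ q , s ∷ a ∷ b ∷ c ∷ []

  cells : List Letter → List Cell
  cells = map (λ l → letter l)

  -- The letters passed are listed nearest first, so `us ʳ++ vs` is the whole word wherever the head
  -- is.
  pos : List Letter → List Letter → Strip
  pos us vs = cells us ++ ⊢ ∷ [] , cells vs ++ ⊣ ∷ []

  home : List Letter → Strip
  home vs = [] , ⊢ ∷ cells vs ++ ⊣ ∷ []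

  step-to : ∀ {c c₁ c′ n} → next c ≡ c₁ → c₁ ⟶[ n ] c′ → c ⟶[ suc n ] c′
  step-to {c} refl p = one {c} p

  rejects-by : ∀ {c} → proj₁ (next c) ≡ inj₂ false → c ⟶[ 1 ] (inj₂ false , proj₂ (next c))
  rejects-by {c} e = one {c} (0 , z≤n , cong (_, proj₂ (next c)) e)

  -- The stack is the part of tape 0 to the left of the head, its top nearest. Cells from the head
  -- on hold discarded letters and frames that are overwritten before they are read; the statements
  -- about the automaton's runs leave them arbitrary.
  stackOn : List Cell → List Frame → List Cell
  stackOn base fs = map (λ f → frame f) fs ++ base

  copied : List Letter → Strip
  copied us = cells us ++ ⊢ ∷ [] , []

  NoHash : List Letter → Set
  NoHash = All (λ a → isHash a ≡ false)

  skip-run : ∀ e x l {b} → NoHash e →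
    conf skip (l , cells e ++ letter # ∷ x) b b b ⟶[ suc (length e) ]
    conf copyX (letter # ∷ (cells e ʳ++ l) , x) b b b
  skip-run []      x l []       = one done
  skip-run (a ∷ e) x l {b} (p ∷ ps) = step-to lemma (skip-run e x (letter a ∷ l) ps)
    where
    lemma : next (conf skip (l , cells (a ∷ e) ++ letter # ∷ x) b b b)
            ≡ conf skip (letter a ∷ l , cells e ++ letter # ∷ x) b b b
    lemma rewrite p = refl

  copyX-run : ∀ x us l → conf copyX (l , cells x) (copied us) (copied us) (copied us) ⟶[ suc (length x) ]
    conf rewX (go left (cells x ʳ++ l , []))
         (copied (# ∷ (x ʳ++ us))) (copied (# ∷ (x ʳ++ us))) (copied (# ∷ (x ʳ++ us)))
  copyX-run []      us l = one done
  copyX-run (a ∷ x) us l = one (copyX-run x (a ∷ us) (letter a ∷ l))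

  rewX-run : ∀ us r {b} →
    conf rewX (go left (cells us , r)) b b b ⟶[ suc (length us) ]
    conf copyE (nothing ∷ [] , cells us ʳ++ fill r) b b b
  rewX-run []       r = one done
  rewX-run (a ∷ us) r = one (rewX-run us (letter a ∷ fill r))

  copyE-run : ∀ e x us l → NoHash e →
    conf copyE (l , cells e ++ letter # ∷ x) (copied us) (copied us) (copied us) ⟶[ suc (length e) ]
    conf rewAll (letter # ∷ (cells e ʳ++ l) , x) (pos (e ʳ++ us) []) (pos (e ʳ++ us) []) (pos (e ʳ++ us) [])
  copyE-run []      x us l []       = one done
  copyE-run (a ∷ e) x us l (p ∷ ps) = step-to lemma (copyE-run e x (a ∷ us) (letter a ∷ l) ps)
    where
    lemma : next (conf copyE (l , cells (a ∷ e) ++ letter # ∷ x) (copied us) (copied us) (copied us))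
            ≡ conf copyE (letter a ∷ l , cells e ++ letter # ∷ x) (copied (a ∷ us)) (copied (a ∷ us)) (copied (a ∷ us))
    lemma rewrite p = refl

  goL-pos : ∀ a us vs → go left (pos (a ∷ us) vs) ≡ pos us (a ∷ vs)
  goL-pos a us []       = refl
  goL-pos a us (v ∷ vs) = refl

  goL-home : ∀ vs → go left (pos [] vs) ≡ home vs
  goL-home []       = refl
  goL-home (v ∷ vs) = refl

  rewAll-run : ∀ us vs {s} →
    conf rewAll s (pos us vs) (pos us vs) (pos us vs) ⟶[ suc (suc (length us)) ]
    conf nextP s (home (us ʳ++ vs)) (home (us ʳ++ vs)) (home (us ʳ++ vs))
  rewAll-run us vs = step-to (lemma us vs) (rest us vs)
    where
    lemma : ∀ us vs {s} → next (conf rewAll s (pos us vs) (pos us vs) (pos us vs))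
                    ≡ conf rewAll s (go left (pos us vs)) (go left (pos us vs)) (go left (pos us vs))
    lemma us []      = refl
    lemma us (_ ∷ _) = refl
    rest : ∀ us vs {s} → conf rewAll s (go left (pos us vs)) (go left (pos us vs)) (go left (pos us vs))
      ⟶[ suc (length us) ] conf nextP s (home (us ʳ++ vs)) (home (us ʳ++ vs)) (home (us ʳ++ vs))
    rest []       vs rewrite goL-home vs = one done
    rest (a ∷ us) vs rewrite goL-pos a us vs = one (rest us (a ∷ vs))

  -- A head comparing the digits after a token's head h: the flag says whether all digits so
  -- far were matched, us lists the digits passed, and vs what lies ahead.
  Tracker : Set
  Tracker = Bool × List Letter × List Letter

  track : Letter → Tracker → Tracker
  track d (false , us , vs)     = false , us , vs
  track d (true  , us , [])     = false , us , []
  track d (true  , us , v ∷ vs) = if same d v then (true , v ∷ us , vs) else (false , us , v ∷ vs)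

  trackAll : List Letter → Tracker → Tracker
  trackAll []       t = t
  trackAll (d ∷ ds) t = trackAll ds (track d t)

  tracked : Letter → List Letter → Tracker → Strip
  tracked h l (_ , us , vs) = pos (us ++ h ∷ l) vs

  advance-track : ∀ h l d t → let (e , m) = advance (proj₁ t) d (scan (tracked h l t)) in
    (e , act m (tracked h l t)) ≡ (proj₁ (track d t) , tracked h l (track d t))
  advance-track h l d (false , us , [])     = refl
  advance-track h l d (false , us , v ∷ vs) = refl
  advance-track h l d (true  , us , [])     = refl
  advance-track h l d (true  , us , v ∷ vs) with same d v
  ... | true  = refl
  ... | false = refl

  matched : Tracker → Bool
  matched (e , us , [])    = e ∧ true
  matched (e , us , v ∷ _) = e ∧ not (isDigit v)

  matched-scan : ∀ h l t → proj₁ t ∧ not (digit? (scan (tracked h l t))) ≡ matched t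
  matched-scan h l (e , us , [])    = refl
  matched-scan h l (e , us , _ ∷ _) = refl

  -- The strip of a tracker whose head has moved one cell to the left.
  returning : Letter → List Letter → List Letter → List Letter → Strip
  returning h l []       vs = pos l (h ∷ vs)
  returning h l (u ∷ us) vs = pos (us ++ h ∷ l) (u ∷ vs)

  goL-tracked : ∀ h l e us vs → go left (tracked h l (e , us , vs)) ≡ returning h l us vs
  goL-tracked h l e []       vs = goL-pos h l vs
  goL-tracked h l e (u ∷ us) vs = goL-pos u (us ++ h ∷ l) vs

  goL-returning : ∀ h l u us vs → go left (returning h l (u ∷ us) vs) ≡ returning h l us (u ∷ vs)
  goL-returning h l u []       vs = refl
  goL-returning h l u (_ ∷ us) vs = refl

  Boundary : List Letter → Set
  Boundary []      = ⊤
  Boundary (v ∷ _) = isDigit v ≡ false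

  module Compare (r : Reading) (h₂ h₃ : Letter) (l₂ l₃ : List Letter) (s : Strip) where

    cmp-run : ∀ ds us vs t₂ t₃ → Digits ds → Boundary vs →
      conf (cmp r (proj₁ t₂) (proj₁ t₃)) s (pos us (ds ++ vs)) (tracked h₂ l₂ t₂) (tracked h₃ l₃ t₃)
      ⟶[ suc (length ds) ]
      (let t₂′ = trackAll ds t₂ ; t₃′ = trackAll ds t₃ in
      conf (back r (matched t₂′) (matched t₃′)) s (pos (ds ʳ++ us) vs)
        (go left (tracked h₂ l₂ t₂′)) (go left (tracked h₃ l₃ t₃′)))
    cmp-run [] us vs t₂ t₃ [] bound = step-to (lemma vs bound) done
      where
      lemma : ∀ vs → Boundary vs →
        next (conf (cmp r (proj₁ t₂) (proj₁ t₃)) s (pos us vs) (tracked h₂ l₂ t₂) (tracked h₃ l₃ t₃)) ≡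
        conf (back r (matched t₂) (matched t₃)) s (pos us vs) (go left (tracked h₂ l₂ t₂)) (go left (tracked h₃ l₃ t₃))
      lemma [] _ = cong₂ (λ e e′ → conf (back r e e′) s (pos us []) (go left (tracked h₂ l₂ t₂)) (go left (tracked h₃ l₃ t₃)))
                         (matched-scan h₂ l₂ t₂) (matched-scan h₃ l₃ t₃)
      lemma (v ∷ vs) p rewrite p =
        cong₂ (λ e e′ → conf (back r e e′) s (pos us (v ∷ vs)) (go left (tracked h₂ l₂ t₂)) (go left (tracked h₃ l₃ t₃)))
              (matched-scan h₂ l₂ t₂) (matched-scan h₃ l₃ t₃)
    cmp-run (d ∷ ds) us vs t₂ t₃ (p ∷ ps) bound =
      step-to lemma (cmp-run ds (d ∷ us) vs (track d t₂) (track d t₃) ps bound)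
      where
      after : Bool × Strip → Bool × Strip → Conf
      after (e , b) (e′ , c) = conf (cmp r e e′) s (pos (d ∷ us) (ds ++ vs)) b c
      lemma : next (conf (cmp r (proj₁ t₂) (proj₁ t₃)) s (pos us (d ∷ ds ++ vs)) (tracked h₂ l₂ t₂) (tracked h₃ l₃ t₃)) ≡
        conf (cmp r (proj₁ (track d t₂)) (proj₁ (track d t₃))) s (pos (d ∷ us) (ds ++ vs))
             (tracked h₂ l₂ (track d t₂)) (tracked h₃ l₃ (track d t₃))
      lemma rewrite p = cong₂ after (advance-track h₂ l₂ d t₂) (advance-track h₃ l₃ d t₃)

    module _ (nd₂ : isDigit h₂ ≡ false) (nd₃ : isDigit h₃ ≡ false) where

      -- Each head walks back over digits and waits at its head letter, which is none. The heads
      -- move simultaneously; the sum of the distances is a convenient bound for their maximum.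
      back-run : ∀ e e′ a us₂ vs₂ us₃ vs₃ → Digits us₂ → Digits us₃ →
        conf (back r e e′) s a (returning h₂ l₂ us₂ vs₂) (returning h₃ l₃ us₃ vs₃) ⟶[ length us₂ + length us₃ ]
        conf (back r e e′) s a (pos l₂ (h₂ ∷ us₂ ʳ++ vs₂)) (pos l₃ (h₃ ∷ us₃ ʳ++ vs₃))
      back-run e e′ a [] vs₂ [] vs₃ [] [] = done
      back-run e e′ a (u ∷ us₂) vs₂ [] vs₃ (p ∷ ps) [] =
        step-to lemma (back-run e e′ a us₂ (u ∷ vs₂) [] vs₃ ps [])
        where
        lemma : next (conf (back r e e′) s a (returning h₂ l₂ (u ∷ us₂) vs₂) (returning h₃ l₃ [] vs₃)) ≡
                conf (back r e e′) s a (returning h₂ l₂ us₂ (u ∷ vs₂)) (returning h₃ l₃ [] vs₃)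
        lemma rewrite p | nd₃ = cong (λ b → conf (back r e e′) s a b (returning h₃ l₃ [] vs₃)) (goL-returning h₂ l₂ u us₂ vs₂)
      back-run e e′ a [] vs₂ (u ∷ us₃) vs₃ [] (p ∷ ps) =
        step-to lemma (back-run e e′ a [] vs₂ us₃ (u ∷ vs₃) [] ps)
        where
        lemma : next (conf (back r e e′) s a (returning h₂ l₂ [] vs₂) (returning h₃ l₃ (u ∷ us₃) vs₃)) ≡
                conf (back r e e′) s a (returning h₂ l₂ [] vs₂) (returning h₃ l₃ us₃ (u ∷ vs₃))
        lemma rewrite p | nd₂ = cong (λ b → conf (back r e e′) s a (returning h₂ l₂ [] vs₂) b) (goL-returning h₃ l₃ u us₃ vs₃)
      back-run e e′ a (u ∷ us₂) vs₂ (w ∷ us₃) vs₃ (p ∷ ps) (p′ ∷ ps′) =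
        within (s≤s (+-monoʳ-≤ (length us₂) (n≤1+n (length us₃))))
          (step-to lemma (back-run e e′ a us₂ (u ∷ vs₂) us₃ (w ∷ vs₃) ps ps′))
        where
        lemma : next (conf (back r e e′) s a (returning h₂ l₂ (u ∷ us₂) vs₂) (returning h₃ l₃ (w ∷ us₃) vs₃)) ≡
                conf (back r e e′) s a (returning h₂ l₂ us₂ (u ∷ vs₂)) (returning h₃ l₃ us₃ (w ∷ vs₃))
        lemma rewrite p | p′ = cong₂ (conf (back r e e′) s a) (goL-returning h₂ l₂ u us₂ vs₂) (goL-returning h₃ l₃ w us₃ vs₃)

  same-digit : ∀ d v → same d v ≡ true → isDigit v ≡ true
  same-digit 𝟙 𝟙 _ = refl
  same-digit 𝟚 𝟚 _ = refl

  -- What the way back requires: no passed cell can be mistaken for a head letter, the way is no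
  -- longer than the name read, and the tape is restored in full.
  record Tracks (all : List Letter) (n : ℕ) (t : Tracker) : Set where
    field
      passed-digits : Digits (proj₁ (proj₂ t))
      passed-length : length (proj₁ (proj₂ t)) ≤ n
      total         : proj₁ (proj₂ t) ʳ++ proj₂ (proj₂ t) ≡ all
  open Tracks

  track-tracks : ∀ {all n t} d → Tracks all n t → Tracks all (suc n) (track d t)
  track-tracks {t = false , us , vs}    d τ = record
    { passed-digits = τ .passed-digits ; passed-length = m≤n⇒m≤1+n (τ .passed-length) ; total = τ .total }
  track-tracks {t = true , us , []}     d τ = record
    { passed-digits = τ .passed-digits ; passed-length = m≤n⇒m≤1+n (τ .passed-length) ; total = τ .total }
  track-tracks {t = true , us , v ∷ vs} d τ with same d v in e
  ... | true  = record
    { passed-digits = same-digit d v e ∷ τ .passed-digits ; passed-length = s≤s (τ .passed-length) ; total = τ .total }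
  ... | false = record
    { passed-digits = τ .passed-digits ; passed-length = m≤n⇒m≤1+n (τ .passed-length) ; total = τ .total }

  trackAll-tracks : ∀ {all n t} ds → Tracks all n t → Tracks all (length ds + n) (trackAll ds t)
  trackAll-tracks []       τ = τ
  trackAll-tracks {all} {n} {t} (d ∷ ds) τ =
    subst (λ m → Tracks all m (trackAll ds (track d t))) (+-suc (length ds) n) (trackAll-tracks ds (track-tracks d τ))

  trackAll-false : ∀ ds us vs → trackAll ds (false , us , vs) ≡ (false , us , vs)
  trackAll-false []       us vs = refl
  trackAll-false (d ∷ ds) us vs = trackAll-false ds us vs

  matched-false : ∀ ds us vs → matched (trackAll ds (false , us , vs)) ≡ false
  matched-false ds us vs rewrite trackAll-false ds us vs with vs
  ... | []    = refl
  ... | _ ∷ _ = refl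

  -- `digits` is injective, and `Boundary` prevents the letters behind `digits x` from prolonging
  -- the name.
  matched-digits : ∀ z x us vs → Boundary vs →
    matched (trackAll (digits z) (true , us , digits x ++ vs)) ≡ does (z ℕᵇ.≟ x)
  matched-digits zero     zero     us []       _ = refl
  matched-digits zero     zero     us (v ∷ vs) p = cong not p
  matched-digits zero     2[1+ x ] us vs       _ = refl
  matched-digits zero     1+[2 x ] us vs       _ = refl
  matched-digits 2[1+ z ] zero     us []       _ = matched-false (digits z) us []
  matched-digits 2[1+ z ] zero     us (v ∷ vs) p with same 𝟚 v in e
  ... | true  with () ← trans (sym p) (same-digit 𝟚 v e)
  ... | false = matched-false (digits z) us (v ∷ vs)
  matched-digits 1+[2 z ] zero     us []       _ = matched-false (digits z) us []
  matched-digits 1+[2 z ] zero     us (v ∷ vs) p with same 𝟙 v in e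
  ... | true  with () ← trans (sym p) (same-digit 𝟙 v e)
  ... | false = matched-false (digits z) us (v ∷ vs)
  matched-digits 2[1+ z ] 2[1+ x ] us vs p = trans (matched-digits z x (𝟚 ∷ us) vs p) (does-map z x)
    where
    does-map : ∀ z x → does (z ℕᵇ.≟ x) ≡ does (2[1+ z ] ℕᵇ.≟ 2[1+ x ])
    does-map z x with z ℕᵇ.≟ x
    ... | yes _ = refl
    ... | no  _ = refl
  matched-digits 1+[2 z ] 1+[2 x ] us vs p = trans (matched-digits z x (𝟙 ∷ us) vs p) (does-map z x)
    where
    does-map : ∀ z x → does (z ℕᵇ.≟ x) ≡ does (1+[2 z ] ℕᵇ.≟ 1+[2 x ])
    does-map z x with z ℕᵇ.≟ x
    ... | yes _ = refl
    ... | no  _ = refl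
  matched-digits 2[1+ z ] 1+[2 x ] us vs p = matched-false (digits z) us (𝟙 ∷ digits x ++ vs)
  matched-digits 1+[2 z ] 2[1+ x ] us vs p = matched-false (digits z) us (𝟚 ∷ digits x ++ vs)

  letters-boundary : ∀ ts → Boundary (letters ts)
  letters-boundary []       = tt
  letters-boundary (t ∷ ts) = head-nondigit t

  home-run : ∀ us vs {s b c} →
    conf rewMain s (pos us vs) b c ⟶[ suc (suc (length us)) ] conf nextQ s (home (us ʳ++ vs)) b c
  home-run us vs = step-to (lemma us vs) (rest us vs)
    where
    lemma : ∀ us vs {s b c} → next (conf rewMain s (pos us vs) b c) ≡ conf rewMain s (go left (pos us vs)) b c
    lemma us []      = refl
    lemma us (_ ∷ _) = refl
    rest : ∀ us vs {s b c} → conf rewMain s (go left (pos us vs)) b c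
      ⟶[ suc (length us) ] conf nextQ s (home (us ʳ++ vs)) b c
    rest []       vs rewrite goL-home vs = one done
    rest (a ∷ us) vs rewrite goL-pos a us vs = one (rest us (a ∷ vs))

  rewQ-run : ∀ us vs {s a b} →
    conf rewQ s a b (pos us vs) ⟶[ suc (suc (length us)) ] conf nextP s a b (home (us ʳ++ vs))
  rewQ-run us vs = step-to (lemma us vs) (rest us vs)
    where
    lemma : ∀ us vs {s a b} → next (conf rewQ s a b (pos us vs)) ≡ conf rewQ s a b (go left (pos us vs))
    lemma us []      = refl
    lemma us (_ ∷ _) = refl
    rest : ∀ us vs {s a b} → conf rewQ s a b (go left (pos us vs))
      ⟶[ suc (length us) ] conf nextP s a b (home (us ʳ++ vs))
    rest []       vs rewrite goL-home vs = one done
    rest (u ∷ us) vs rewrite goL-pos u us vs = one (rest us (u ∷ vs))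

  -- Time bounds for one pass and for the loops over pairs

  -- The Boolean selects the exit: back into the loop, with some debris `r` on tape 0, or rejection
  -- once and for all. A conjunction over pairs is thus evaluated lazily.
  data Outcome : Bool → Conf → ℕ → (List Cell → Conf) → Set where
    goes-on : ∀ {c n C} r  → c ⟶[ n ] C r → Outcome true c n C
    rejects : ∀ {c n C} ts → c ⟶[ n ] (inj₂ false , ts) → Outcome false c n C

  prefix : ∀ {a b m n v C} → a ⟶[ m ] b → Outcome v b n C → Outcome v a (m + n) C
  prefix p (goes-on r q)  = goes-on r (p ▷ q)
  prefix p (rejects ts q) = rejects ts (p ▷ q)

  relax : ∀ {a m n v C} → m ≤ n → Outcome v a m C → Outcome v a n C
  relax le (goes-on r q)  = goes-on r (within le q)
  relax le (rejects ts q) = rejects ts (within le q)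

  and-then : ∀ {a m n v w C D} → Outcome v a m C → (∀ r → Outcome w (C r) n D) → Outcome (v ∧ w) a (m + n) D
  and-then                 (goes-on r p)  k = prefix p (k r)
  and-then {m = m} {n = n} (rejects ts p) k = rejects ts (within (m≤m+n m n) p)

  and-halts : ∀ {a m n v w C} → Outcome v a m C → (∀ r → Halts (C r) n w) → Halts a (m + n) (v ∧ w)
  and-halts                 (goes-on r p)  k = let (ts , q) = k r in ts , (p ▷ q)
  and-halts {m = m} {n = n} (rejects ts p) k = ts , within (m≤m+n m n) p

  -- The stack lies on top of the letters of E, below which the head never looks.
  module Pass (under : List Cell)
    (h₂ h₃ : Letter) (nd₂ : isDigit h₂ ≡ false) (nd₃ : isDigit h₃ ≡ false)
    (l₂ l₃ v₂ v₃ : List Letter) (bound₂ : Boundary v₂) (bound₃ : Boundary v₃) (x y : Var) where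

    open Runs A x y

    base : List Cell
    base = letter # ∷ under

    headP headQ : Strip
    headP = pos l₂ (h₂ ∷ digits x ++ v₂)
    headQ = pos l₃ (h₃ ∷ digits y ++ v₃)

    at : Q → List Frame → List Cell → List Letter → List Letter → Conf
    at q fs r us vs = conf q (stackOn base fs , r) (pos us vs) headP headQ

    -- For a name of d digits: 1 step over the head letter, d + 1 steps of comparison, at most d + d
    -- steps for the two heads to return.
    read-run : ∀ r fs c us t ts →
      ∃[ r′ ] at (pass (inj₁ r)) fs c us (letters (t ∷ ts)) ⟶[ 2 + 3 * length (digits (name t)) ]
              at (back r (proj₁ (marks t)) (proj₂ (marks t))) fs (letter (head t) ∷ r′)
                 (digits (name t) ʳ++ head t ∷ us) (letters ts)
    read-run r fs c us t ts = drop 1 c , within (≤-reflexive (count (length ds)))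
      (one (within (s≤s (+-monoʳ-≤ (length ds) (+-mono-≤ (bounded-length t₂ τ₂) (bounded-length t₃ τ₃))))
        (cmp-run ds (head t ∷ us) (letters ts) (true , [] , digits x ++ v₂) (true , [] , digits y ++ v₃)
           (digits-digits (name t)) (letters-boundary ts)
         ▷ subst₂ _⟶[ length (proj₁ (proj₂ t₂)) + length (proj₁ (proj₂ t₃)) ]_
             (cong₂ (conf q s a) (sym (goL-tracked h₂ l₂ (proj₁ t₂) (proj₁ (proj₂ t₂)) (proj₂ (proj₂ t₂))))
                                 (sym (goL-tracked h₃ l₃ (proj₁ t₃) (proj₁ (proj₂ t₃)) (proj₂ (proj₂ t₃)))))
             (trans (cong₂ (λ vs vs′ → conf q s a (pos l₂ (h₂ ∷ vs)) (pos l₃ (h₃ ∷ vs′))) (τ₂ .total) (τ₃ .total))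
                    (cong₂ (λ e e′ → conf (back r e e′) s a headP headQ)
                           (matched-digits (name t) x [] v₂ bound₂) (matched-digits (name t) y [] v₃ bound₃)))
             (back-run nd₂ nd₃ (matched t₂) (matched t₃) a _ _ _ _ (τ₂ .passed-digits) (τ₃ .passed-digits)))))
      where
      s = stackOn base fs , letter (head t) ∷ drop 1 c
      open Compare r h₂ h₃ l₂ l₃ s
      ds = digits (name t)
      a = pos (ds ʳ++ head t ∷ us) (letters ts)
      t₂ = trackAll ds (true , [] , digits x ++ v₂)
      t₃ = trackAll ds (true , [] , digits y ++ v₃)
      q = back r (matched t₂) (matched t₃)
      τ₂ : Tracks (digits x ++ v₂) (length ds + 0) t₂
      τ₂ = trackAll-tracks ds (record { passed-digits = [] ; passed-length = z≤n ; total = refl })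
      τ₃ : Tracks (digits y ++ v₃) (length ds + 0) t₃
      τ₃ = trackAll-tracks ds (record { passed-digits = [] ; passed-length = z≤n ; total = refl })
      bounded-length : ∀ {all} t → Tracks all (length ds + 0) t → length (proj₁ (proj₂ t)) ≤ length ds
      bounded-length t τ = subst (length (proj₁ (proj₂ t)) ≤_) (+-identityʳ (length ds)) (τ .passed-length)
      count : ∀ d → suc (suc d + (d + d)) ≡ 2 + 3 * d
      count = solve-∀

    target : List Letter → List Cell → Conf
    target word r = conf nextQ (base , r) (home word) headP headQ

    -- A token with d digits costs 2 + 3 d steps to compare and 1 to act upon, at most 2 for popping
    -- a frame that it pushes, and d + 1 for rewinding over it later, altogether 6 + 4 d, which is
    -- at most 6 per letter. Frames already on the stack and letters already passed are charged
    -- likewise; 5 covers the ending.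
    pass-bound : List Frame → List Letter → List Letter → ℕ
    pass-bound fs us vs = 6 * length vs + 2 * length fs + length us + 5

    below-bound : ∀ fs us vs {k} → k ≤ 5 → k ≤ pass-bound fs us vs
    below-bound fs us vs k≤5 = ≤-trans k≤5 (m≤n+m 5 (6 * length vs + 2 * length fs + length us))

    push-bound : ∀ fs us ts f → pass-bound (push f fs) us (letters ts) ≤
      6 * length (letters ts) + 2 * suc (length fs) + length us + 5
    push-bound fs us ts (just f) = ≤-refl
    push-bound fs us ts nothing  = +-monoˡ-≤ 5 (+-monoˡ-≤ (length us)
      (+-monoʳ-≤ (6 * length (letters ts)) (*-monoʳ-≤ 2 (n≤1+n (length fs)))))

    read-bound : ∀ fs us t ts →
      2 + 3 * length (digits (name t)) +
        suc (6 * length (letters ts) + 2 * suc (length fs) + length (digits (name t) ʳ++ head t ∷ us) + 5)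
      ≤ pass-bound fs us (letters (t ∷ ts))
    read-bound fs us t ts = begin
      2 + 3 * d + suc (6 * l + 2 * suc (length fs) + length (digits (name t) ʳ++ head t ∷ us) + 5)
        ≡⟨ cong (λ n → 2 + 3 * d + suc (6 * l + 2 * suc (length fs) + n + 5)) (length-ʳ++ (digits (name t))) ⟩
      2 + 3 * d + suc (6 * l + 2 * suc (length fs) + (d + suc (length us)) + 5)
        ≤⟨ m≤m+n _ (2 * d) ⟩
      2 + 3 * d + suc (6 * l + 2 * suc (length fs) + (d + suc (length us)) + 5) + 2 * d
        ≡⟨ count d l (length fs) (length us) ⟩
      6 * suc (d + l) + 2 * length fs + length us + 5
        ≡⟨ cong (λ n → 6 * suc n + 2 * length fs + length us + 5) (length-++ (digits (name t))) ⟨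
      6 * suc (length (digits (name t) ++ letters ts)) + 2 * length fs + length us + 5 ∎
      where
      open ≤-Reasoning
      d = length (digits (name t))
      l = length (letters ts)
      count : ∀ d l f u → 2 + 3 * d + suc (6 * l + 2 * suc f + (d + suc u) + 5) + 2 * d ≡ 6 * suc (d + l) + 2 * f + u + 5
      count = solve-∀

    pass-run  : ∀ c fs r us ts → Outcome (accepts c fs ts) (at (pass c) fs r us (letters ts))
      (pass-bound fs us (letters ts)) (target (us ʳ++ letters ts))
    -- The result of `read` is a variable `a` tied by an equation, so that matching on it makes the
    -- automaton and the machine compute in step.
    shift-run : ∀ r e e′ l a fs r₀ us ts n → (∀ f → pass-bound (push f fs) us (letters ts) ≤ n) →
      read r l (e , e′) ≡ a →
      Outcome (Runs.shift A x y a fs ts) (at (back r e e′) fs (letter l ∷ r₀) us (letters ts))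
        (suc n) (target (us ʳ++ letters ts))

    pass-run (inj₁ r) fs r₀ us [] with accepting r in e
    ... | false = rejects _ (within (below-bound fs us [] (s≤s z≤n)) (rejects-by lemma))
      where
      lemma : proj₁ (next (at (pass (inj₁ r)) fs r₀ us [])) ≡ inj₂ false
      lemma rewrite e = refl
    pass-run (inj₁ r) (f ∷ fs) r₀ us [] | true =
      rejects _ (within (below-bound (f ∷ fs) us [] (s≤s (s≤s z≤n))) (step-to lemma (one done)))
      where
      lemma : next (at (pass (inj₁ r)) (f ∷ fs) r₀ us []) ≡
              conf bottom (stackOn base fs , frame f ∷ fill r₀) (pos us []) headP headQ
      lemma rewrite e = refl
    pass-run (inj₁ r) [] r₀ us [] | true =
      goes-on (fill r₀) (within (≤-trans (≤-reflexive (+-comm 4 (length us))) (+-monoʳ-≤ (length us) (n≤1+n 4)))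
        (step-to lemma (one (home-run us []))))
      where
      lemma : next (at (pass (inj₁ r)) [] r₀ us []) ≡ conf bottom (under , letter # ∷ fill r₀) (pos us []) headP headQ
      lemma rewrite e = refl
    pass-run (inj₁ r) fs r₀ us (t ∷ ts) =
      let (r₁ , p) = read-run r fs r₀ us t ts
          us′ = digits (name t) ʳ++ head t ∷ us
          b = 2 + 3 * length (digits (name t))
          q = shift-run r (proj₁ (marks t)) (proj₂ (marks t)) (head t) _ fs r₁ us′ ts
                (6 * length (letters ts) + 2 * suc (length fs) + length us′ + 5) (push-bound fs us′ ts) refl
      in subst (λ w → Outcome (accepts (inj₁ r) fs (t ∷ ts)) (at (pass (inj₁ r)) fs r₀ us (letters (t ∷ ts)))
                        (pass-bound fs us (letters (t ∷ ts))) (target w))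
               (ʳ++-ʳ++ (digits (name t)))
               (relax (read-bound fs us t ts) (prefix p q))
    pass-run (inj₂ p) [] r₀ us ts = rejects _ (within (below-bound [] us (letters ts) (s≤s (s≤s z≤n))) (one (one done)))
    pass-run (inj₂ p) (f ∷ fs) r₀ us ts with pop p f in e
    ... | nothing = rejects _ (within (below-bound (f ∷ fs) us (letters ts) (s≤s (s≤s z≤n))) (one (rejects-by lemma)))
      where
      lemma : proj₁ (next (conf (popping p) (stackOn base fs , frame f ∷ fill r₀) (pos us (letters ts)) headP headQ)) ≡ inj₂ false
      lemma rewrite e = refl
    ... | just c  = relax (≤-reflexive (count (length (letters ts)) (length fs) (length us)))
        (prefix (one (step-to lemma done)) (pass-run c fs (frame f ∷ fill r₀) us ts))
      where
      lemma : next (conf (popping p) (stackOn base fs , frame f ∷ fill r₀) (pos us (letters ts)) headP headQ) ≡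
              at (pass c) fs (frame f ∷ fill r₀) us (letters ts)
      lemma rewrite e = refl
      count : ∀ l f u → 2 + (6 * l + 2 * f + u + 5) ≡ 6 * l + 2 * suc f + u + 5
      count = solve-∀

    shift-run r e e′ l nothing fs r₀ us ts n _ e₀ = rejects _ (within (s≤s z≤n) (rejects-by lemma))
      where
      lemma : proj₁ (next (at (back r e e′) fs (letter l ∷ r₀) us (letters ts))) ≡ inj₂ false
      lemma rewrite nd₂ | nd₃ | e₀ = refl
    shift-run r e e′ l (just (c , nothing)) fs r₀ us ts n b e₀ =
      relax (s≤s (b nothing)) (prefix (step-to lemma done) (pass-run c fs (letter l ∷ r₀) us ts))
      where
      lemma : next (at (back r e e′) fs (letter l ∷ r₀) us (letters ts)) ≡ at (pass c) fs (letter l ∷ r₀) us (letters ts)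
      lemma rewrite nd₂ | nd₃ | e₀ = refl
    shift-run r e e′ l (just (c , just f)) fs r₀ us ts n b e₀ =
      relax (s≤s (b (just f))) (prefix (step-to lemma done) (pass-run c (f ∷ fs) r₀ us ts))
      where
      lemma : next (at (back r e e′) fs (letter l ∷ r₀) us (letters ts)) ≡ at (pass c) (f ∷ fs) r₀ us (letters ts)
      lemma rewrite nd₂ | nd₃ | e₀ = refl

  accepted : List Token → Var → Var → Bool
  accepted ts x y = Runs.accepts A x y (inj₁ opening) [] ts

  -- Tokens other than variables contribute the name `zero`. The extra pairs are harmless because a
  -- valid input is accepted for all pairs whatsoever.
  all-accepted : List Token → Bool
  all-accepted ts = all (λ t → all (λ u → accepted ts (name t) (name u)) ts) ts

  module Loops (under : List Cell) (toks : List Token) where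

    base : List Cell
    base = letter # ∷ under

    word : List Letter
    word = letters toks

    N : ℕ
    N = length word

    -- Here d counts the digits left in the current token and l the letters of the tokens after it.
    -- A pair costs 6 N + 5 for its pass and 2 for entering it and moving on; N + 3 rewinds tape 3.
    -- Charging this price to every letter also covers the single steps over digits. In `p-bound`
    -- the 3 are the steps around the inner loop, and the final 1 is acceptance.
    q-bound : ℕ → ℕ → ℕ
    q-bound d l = d + l * (6 * N + 7) + N + 3

    p-bound : ℕ → ℕ → ℕ
    p-bound d l = d + l * (q-bound 0 N + 3) + 1

    module _ (h₂ : Letter) (nd₂ : isDigit h₂ ≡ false) (l₂ v₂ : List Letter) (bound₂ : Boundary v₂) (x : Var) where

      q-run : ∀ ds us ts r → Digits ds → us ʳ++ (ds ++ letters ts) ≡ word →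
        Outcome (all (λ u → accepted toks x (name u)) ts)
          (conf seekQ (base , r) (home word) (pos l₂ (h₂ ∷ digits x ++ v₂)) (pos us (ds ++ letters ts)))
          (q-bound (length ds) (length (letters ts)))
          (λ r → conf nextP (base , r) (home word) (pos l₂ (h₂ ∷ digits x ++ v₂)) (home word))
      q-run (d ∷ ds) us ts r (p ∷ ps) inv = prefix (step-to lemma done) (q-run ds (d ∷ us) ts r ps inv)
        where
        lemma : ∀ {a b} → next (conf seekQ (base , r) a b (pos us (d ∷ ds ++ letters ts))) ≡
                conf seekQ (base , r) a b (pos (d ∷ us) (ds ++ letters ts))
        lemma rewrite p = refl
      q-run [] us [] r [] inv = goes-on r
        (within (≤-reflexive (trans (cong (3 +_) length-us) (+-comm 3 N)))
          (one (subst (λ w → conf rewQ (base , r) (home word) headP (pos us []) ⟶[ suc (suc (length us)) ]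
                             conf nextP (base , r) (home word) headP (home w)) inv (rewQ-run us []))))
        where
        headP = pos l₂ (h₂ ∷ digits x ++ v₂)
        length-us : length us ≡ N
        length-us = trans (sym (+-identityʳ (length us))) (trans (sym (length-ʳ++ us)) (cong length inv))
      q-run [] us (t ∷ ts) r [] inv = relax count
        (prefix (step-to lemma done)
          (and-then (Pass.pass-run under h₂ (head t) nd₂ (head-nondigit t) l₂ us v₂ (letters ts) bound₂ (letters-boundary ts)
                       x (name t) (inj₁ opening) [] r [] toks)
             λ r′ → prefix (one done) (q-run (digits (name t)) (head t ∷ us) ts r′ (digits-digits (name t)) inv)))
        where
        headP = pos l₂ (h₂ ∷ digits x ++ v₂)
        lemma : next (conf seekQ (base , r) (home word) headP (pos us (letters (t ∷ ts)))) ≡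
                conf (pass (inj₁ opening)) (base , r) (pos [] word) headP (pos us (letters (t ∷ ts)))
        lemma rewrite head-nondigit t = refl
        d = length (digits (name t))
        l = length (letters ts)
        open ≤-Reasoning
        split : ∀ n d l m → 1 + (6 * n + 0 + 0 + 5 + (1 + (d + l * (6 * n + 7) + m + 3))) ≡ 6 * n + 7 + (d + l * (6 * n + 7)) + m + 3
        split = solve-∀
        regroup : ∀ k d l m → k + (d * k + l * k) + m + 3 ≡ suc (d + l) * k + m + 3
        regroup = solve-∀
        count : 1 + (6 * N + 0 + 0 + 5 + (1 + q-bound d l)) ≤ q-bound 0 (length (letters (t ∷ ts)))
        count = begin
          1 + (6 * N + 0 + 0 + 5 + (1 + q-bound d l))                   ≡⟨ split N d l N ⟩
          6 * N + 7 + (d + l * (6 * N + 7)) + N + 3                     ≤⟨ +-monoˡ-≤ 3 (+-monoˡ-≤ N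
                                                                             (+-monoʳ-≤ (6 * N + 7) (+-monoˡ-≤ (l * (6 * N + 7)) (d≤ d)))) ⟩
          6 * N + 7 + (d * (6 * N + 7) + l * (6 * N + 7)) + N + 3       ≡⟨ regroup (6 * N + 7) d l N ⟩
          suc (d + l) * (6 * N + 7) + N + 3                             ≡⟨ cong (λ n → suc n * (6 * N + 7) + N + 3) (length-++ (digits (name t))) ⟨
          q-bound 0 (length (letters (t ∷ ts)))                         ∎
          where
          d≤ : ∀ d → d ≤ d * (6 * N + 7)
          d≤ d = ≤-trans (≤-reflexive (sym (*-identityʳ d))) (*-monoʳ-≤ d (≤-trans (s≤s z≤n) (m≤n+m 7 (6 * N))))

    p-run : ∀ ds us ts r → Digits ds → us ʳ++ (ds ++ letters ts) ≡ word →
      Halts (conf seekP (base , r) (home word) (pos us (ds ++ letters ts)) (home word))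
        (p-bound (length ds) (length (letters ts)))
        (all (λ t → all (λ u → accepted toks (name t) (name u)) toks) ts)
    p-run (d ∷ ds) us ts r (p ∷ ps) inv = let (s , h) = p-run ds (d ∷ us) ts r ps inv in s , step-to lemma h
      where
      lemma : ∀ {a c} → next (conf seekP (base , r) a (pos us (d ∷ ds ++ letters ts)) c) ≡
              conf seekP (base , r) a (pos (d ∷ us) (ds ++ letters ts)) c
      lemma rewrite p = refl
    p-run [] us [] r [] inv = _ , one done
    p-run [] us (t ∷ ts) r [] inv =
      let (s , h) = and-halts (prefix (step-to lemma (one done))
                      (q-run (head t) (head-nondigit t) us (letters ts) (letters-boundary ts) (name t) [] [] toks r [] refl))
                      λ r′ → let (s , h) = p-run (digits (name t)) (head t ∷ us) ts r′ (digits-digits (name t)) inv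
                             in s , one h
      in s , within count h
      where
      lemma : next (conf seekP (base , r) (home word) (pos us (letters (t ∷ ts))) (home word)) ≡
              conf nextQ (base , r) (home word) (pos us (letters (t ∷ ts))) (home word)
      lemma rewrite head-nondigit t = refl
      d = length (digits (name t))
      l = length (letters ts)
      open ≤-Reasoning
      split : ∀ k d l → 2 + k + suc (d + l * (k + 3) + 1) ≡ k + 3 + (d + l * (k + 3)) + 1
      split = solve-∀
      regroup : ∀ k d l → k + (d * k + l * k) + 1 ≡ suc (d + l) * k + 1
      regroup = solve-∀
      K = q-bound 0 N + 3
      count : 2 + q-bound 0 N + suc (p-bound d l) ≤ p-bound 0 (length (letters (t ∷ ts)))
      count = begin
        2 + q-bound 0 N + suc (p-bound d l)   ≡⟨ split (q-bound 0 N) d l ⟩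
        K + (d + l * K) + 1                   ≤⟨ +-monoˡ-≤ 1 (+-monoʳ-≤ K (+-monoˡ-≤ (l * K) (d≤ d))) ⟩
        K + (d * K + l * K) + 1               ≡⟨ regroup K d l ⟩
        suc (d + l) * K + 1                   ≡⟨ cong (λ n → suc n * K + 1) (length-++ (digits (name t))) ⟨
        p-bound 0 (length (letters (t ∷ ts))) ∎
        where
        d≤ : ∀ d → d ≤ d * K
        d≤ d = ≤-trans (≤-reflexive (sym (*-identityʳ d))) (*-monoʳ-≤ d (≤-trans (s≤s z≤n) (m≤n+m 3 (q-bound 0 N))))

  -- Encoded inputs, the set-up phase and the cubic bound

  letters-++ : ∀ ts us → letters (ts ++ us) ≡ letters ts ++ letters us
  letters-++ []       us = refl
  letters-++ (t ∷ ts) us = cong (head t ∷_)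
    (trans (cong (digits (name t) ++_) (letters-++ ts us)) (sym (++-assoc (digits (name t)) (letters ts) (letters us))))

  encodeSymbol-letters : ∀ s → encodeSymbol s ≡ head (just s) ∷ digits (name (just s))
  encodeSymbol-letters (var _) = refl
  encodeSymbol-letters `∈      = refl
  encodeSymbol-letters `=      = refl
  encodeSymbol-letters `¬      = refl
  encodeSymbol-letters `∧      = refl
  encodeSymbol-letters `∨      = refl
  encodeSymbol-letters `∃      = refl
  encodeSymbol-letters `⟦      = refl
  encodeSymbol-letters `∣      = refl
  encodeSymbol-letters `⟧      = refl
  encodeSymbol-letters `⟨      = refl
  encodeSymbol-letters `⟩      = refl

  encode-E : ∀ E → concatMap encodeSymbol E ≡ letters (map just E)
  encode-E []      = refl
  encode-E (s ∷ E) = cong₂ _++_ (encodeSymbol-letters s) (encode-E E)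

  encode-X : ∀ X → concatMap encodeVar X ≡ letters (map (just ∘ var) X)
  encode-X []      = refl
  encode-X (x ∷ X) = cong (encodeVar x ++_) (encode-X X)

  digits-no-hash : ∀ x → NoHash (digits x)
  digits-no-hash zero     = []
  digits-no-hash 2[1+ x ] = refl ∷ digits-no-hash x
  digits-no-hash 1+[2 x ] = refl ∷ digits-no-hash x

  symbol-no-hash : ∀ s → isHash (head (just s)) ≡ false
  symbol-no-hash (var _) = refl
  symbol-no-hash `∈      = refl
  symbol-no-hash `=      = refl
  symbol-no-hash `¬      = refl
  symbol-no-hash `∧      = refl
  symbol-no-hash `∨      = refl
  symbol-no-hash `∃      = refl
  symbol-no-hash `⟦      = refl
  symbol-no-hash `∣      = refl
  symbol-no-hash `⟧      = refl
  symbol-no-hash `⟨      = refl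
  symbol-no-hash `⟩      = refl

  E-no-hash : ∀ E → NoHash (letters (map just E))
  E-no-hash []      = []
  E-no-hash (s ∷ E) = symbol-no-hash s ∷ ++⁺ (digits-no-hash (name (just s))) (E-no-hash E)

  -- E is crossed four times (skipped, rewound over, copied, rewound on the copies) and X three
  -- times, hence the factor 4. Tape 0 ends just behind the separator, where the stack will
  -- overwrite X.
  init-run : ∀ e x → NoHash e →
    ∃[ r ] start (e ++ # ∷ x) ⟶[ 4 * length (x ++ # ∷ e) + 8 ]
      conf seekP (letter # ∷ (cells e ʳ++ nothing ∷ []) , r)
                 (home (x ++ # ∷ e)) (pos [] (x ++ # ∷ e)) (home (x ++ # ∷ e))
  init-run e x nh = _ , within count
    (one (subst (λ w → conf skip ([] , w) (copied []) (copied []) (copied []) ⟶[ suc (length e) ]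
                      conf copyX (letter # ∷ (cells e ʳ++ []) , cells x) (copied []) (copied []) (copied [])) (sym (map-++ _ e (# ∷ x)))
             (skip-run e (cells x) [] nh)
     ▷ copyX-run x [] (letter # ∷ (cells e ʳ++ []))
     ▷ subst₂ (λ l r → conf rewX (go left (l , [])) b b b ⟶[ suc (length us) ] conf copyE (nothing ∷ [] , r) b b b)
         cells-us (trans (cong (_ʳ++ nothing ∷ []) cells-us) unwind) (rewX-run us [])
     ▷ copyE-run e (cells x ++ nothing ∷ []) (# ∷ (x ʳ++ [])) (nothing ∷ []) nh
     ▷ subst (λ w → conf rewAll s (pos vs []) (pos vs []) (pos vs []) ⟶[ suc (suc (length vs)) ]
                    conf nextP s (home w) (home w) (home w)) word (rewAll-run vs [])
     ▷ one done))
    where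
    us = x ʳ++ # ∷ (e ʳ++ [])
    vs = e ʳ++ # ∷ (x ʳ++ [])
    b = copied (# ∷ (x ʳ++ []))
    s = letter # ∷ (cells e ʳ++ nothing ∷ []) , cells x ++ nothing ∷ []
    cells-us : cells us ≡ cells x ʳ++ letter # ∷ (cells e ʳ++ [])
    cells-us = trans (map-ʳ++ _ x) (cong (λ l → cells x ʳ++ letter # ∷ l) (map-ʳ++ _ e))
    unwind : (cells x ʳ++ letter # ∷ (cells e ʳ++ [])) ʳ++ nothing ∷ [] ≡ cells e ++ letter # ∷ cells x ++ nothing ∷ []
    unwind = trans (ʳ++-ʳ++ (cells x)) (ʳ++-ʳ++ (cells e))
    word : vs ʳ++ [] ≡ x ++ # ∷ e
    word = trans (ʳ++-ʳ++ e) (trans (ʳ++-ʳ++ x) (cong (λ e → x ++ # ∷ e) (++-identityʳ e)))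
    count : suc (suc (length e) + (suc (length x) + (suc (length us) + (suc (length e) + (suc (suc (length vs)) + 1)))))
            ≤ 4 * length (x ++ # ∷ e) + 8
    count rewrite length-ʳ++ x {# ∷ (e ʳ++ [])} | length-ʳ++ e {# ∷ (x ʳ++ [])} | length-ʳ++ x {[]} | length-ʳ++ e {[]} | length-++ x {# ∷ e}
      = ≤-trans (m≤m+n _ (2 + length x)) (≤-reflexive (eqn (length e) (length x)))
      where
      eqn : ∀ e x → suc (suc e + (suc x + (suc (x + suc (e + 0)) + (suc e + (suc (suc (e + suc (x + 0))) + 1))))) + (2 + x)
            ≡ 4 * (x + suc e) + 8
      eqn = solve-∀

  n≤n² : ∀ n → n ≤ n * n
  n≤n² zero    = z≤n
  n≤n² (suc n) = m≤m*n (suc n) (suc n)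

  -- The left side is the set-up time plus `p-bound 0 n`. Raising each power of n to the third gives
  -- the coefficient 6 + 8 + 10 = 24; the constant 9 is rounded up to the same number.
  cubic : ∀ n → 4 * n + 8 + (n * (n * (6 * n + 7) + n + 3 + 3) + 1) ≤ 24 * n ^ 3 + 24
  cubic n = begin
    4 * n + 8 + (n * (n * (6 * n + 7) + n + 3 + 3) + 1)  ≡⟨ expand n ⟩
    6 * (n * (n * n)) + 8 * (n * n) + 10 * n + 9         ≤⟨ +-mono-≤ (+-mono-≤ (+-monoʳ-≤ (6 * (n * (n * n)))
                                                              (*-monoʳ-≤ 8 (*-monoʳ-≤ n (n≤n² n))))
                                                              (*-monoʳ-≤ 10 (≤-trans (n≤n² n) (*-monoʳ-≤ n (n≤n² n)))))
                                                              (m≤m+n 9 15) ⟩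
    6 * (n * (n * n)) + 8 * (n * (n * n)) + 10 * (n * (n * n)) + 24 ≡⟨ collect n ⟩
    24 * n ^ 3 + 24 ∎
    where
    open ≤-Reasoning
    expand : ∀ n → 4 * n + 8 + (n * (n * (6 * n + 7) + n + 3 + 3) + 1) ≡ 6 * (n * (n * n)) + 8 * (n * n) + 10 * n + 9
    expand = solve-∀
    collect : ∀ n → 6 * (n * (n * n)) + 8 * (n * (n * n)) + 10 * (n * (n * n)) + 24 ≡ 24 * (n * (n * (n * 1))) + 24
    collect = solve-∀

  machine-answers : ∀ i → AnswersWithin machine (24 * length (encode i) ^ 3 + 24) (encode i) (all-accepted (tokens i))
  machine-answers i@(E , X) = subst (λ w → AnswersWithin machine (24 * length w ^ 3 + 24) w (all-accepted ts)) (sym word)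
    (answers (let (r , p) = init-run e x (E-no-hash E)
                  (s , q) = p-run [] [] ts r [] refl
              in s , within bound (subst (λ w → start (e ++ # ∷ x) ⟶[ 4 * length w + 8 ]
                                         conf seekP (base , r) (home w) (pos [] w) (home w)) (sym x#e) p ▷ q)))
    where
    e = letters (map just E)
    x = letters (map (just ∘ var) X)
    ts = tokens i
    open Loops (cells e ʳ++ nothing ∷ []) ts hiding (word)
    word : encode i ≡ e ++ # ∷ x
    word = cong₂ (λ e x → e ++ # ∷ x) (encode-E E) (encode-X X)
    x#e : letters ts ≡ x ++ # ∷ e
    x#e = letters-++ (map (just ∘ var) X) (nothing ∷ map just E)
    length-word : length (letters ts) ≡ length (e ++ # ∷ x)
    length-word = trans (cong length x#e) (trans (length-++ x) (trans (+-suc (length x) (length e))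
      (trans (cong suc (+-comm (length x) (length e))) (sym (trans (length-++ e) (+-suc (length e) (length x)))))))
    bound : 4 * length (letters ts) + 8 + p-bound 0 (length (letters ts)) ≤ 24 * length (e ++ # ∷ x) ^ 3 + 24
    bound = ≤-trans (cubic (length (letters ts))) (≤-reflexive (cong (λ n → 24 * n ^ 3 + 24) length-word))

-- The automaton for RST

infixl 6 _⊔_ _⊖_

_⊔_ _⊖_ : Bits → Bits → Bits
(a , a′) ⊔ (b , b′) = a ∨ b , a′ ∨ b′
(a , a′) ⊖ (b , b′) = a ∧ not b , a′ ∧ not b′

none : Bits
none = false , false

both : (Bool → Bool → Bool) → Bits → Bits → Bool
both p (a , a′) (b , b′) = p a b ∧ p a′ b′

_⇒_ : Bool → Bool → Bool
a ⇒ b = not a ∨ b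

_⇔ᵇ_ : Bool → Bool → Bool
true  ⇔ᵇ b = b
false ⇔ᵇ b = not b

-- What is asked of a formula φ: to be a formula of RST (free), or to satisfy φ ≻ Z ∩ Fv φ,
-- where the bits tell which of x and y belong to Z.
Demand : Set
Demand = ⊤ ⊎ Bits

pattern free    = inj₁ tt
pattern bound z = inj₂ z

demand : Demand → (Bits → Bool) → Bool
demand free      p = true
demand (bound z) p = p z

update : (Bits → Bits) → Demand → Demand
update h free      = free
update h (bound z) = bound (h z)

-- A term is summarised by whether it is a variable and which of x and y are free in it.
Kind : Set
Kind = Bool × Bits

-- For one variable: v and v′ say whether the two sides are variables, z whether it lies in Z, f and
-- f′ whether it is free in either side. A side that is a variable and in which it is free is that
-- variable itself. So v, v′, f and f′ together mean x ∈ x, which `mem-ok` admits.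
eq-ok mem-ok : Bool → Bool → Bool → Bool → Bool → Bool
eq-ok  v v′ z f f′ = (z ∧ (f ∨ f′)) ⇒ ((v ∧ f ∧ not f′) ∨ (v′ ∧ f′ ∧ not f))
mem-ok v v′ z f f′ = (z ∧ (f ∨ f′)) ⇒ (v ∧ f ∧ (not f′ ∨ v′))

-- x = y is the only atomic formula that is safe for {x} and for {y} but not for {x , y}.
one-side : Bool → Bool → Bits → Bits → Bits → Bool
one-side v v′ (z , z′) (f , _) (_ , f′) = not (v ∧ v′ ∧ f ∧ z ∧ f′ ∧ z′)

pattern ≐ᵒ = true
pattern ∈ᵒ = false

atom-ok : Bool → Kind → Kind → Bits → Bool
atom-ok ≐ᵒ (v , f₁ , f₂) (v′ , f₁′ , f₂′) (z₁ , z₂) =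
  eq-ok v v′ z₁ f₁ f₁′ ∧ eq-ok v v′ z₂ f₂ f₂′ ∧ one-side v v′ (z₁ , z₂) (f₁ , f₂) (f₁′ , f₂′)
atom-ok ∈ᵒ (v , f₁ , f₂) (v′ , f₁′ , f₂′) (z₁ , z₂) = mem-ok v v′ z₁ f₁ f₁′ ∧ mem-ok v v′ z₂ f₂ f₂′

disjoint-ok : Bits → Bits → Bool
disjoint-ok = both (λ z f → not (z ∧ f))

bind-ok : Bits → Bits → Bool
bind-ok = both _⇒_

-- Both disjuncts must be safe for the same set, which then lies in the free variables of each: Z
-- has to meet both sets of free variables in the same way.
or-ok : Bits → Bits → Bits → Bool
or-ok (f , f′) (g , g′) (z , z′) = ((z ∧ f) ⇔ᵇ (z ∧ g)) ∧ ((z′ ∧ f′) ⇔ᵇ (z′ ∧ g′))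

data Goal : Set where
  term formula safe : Goal

Reading Popping Frame : Set
Reading = Fin 3 ⊎ Bits ⊎ (Demand × Bits) ⊎ Bits ⊎ Bits ⊎ (Demand × Kind) ⊎ Demand ⊎ Bits ⊎ Demand
Popping = Bits ⊎ Kind
Frame   = ⊤ ⊎ Bits ⊎ Demand ⊎ Demand ⊎ Bits ⊎ (Demand × Bits) ⊎ (Demand × Bits) ⊎ Bits ⊎ Demand ⊎ (Demand × Bool × Kind)

pattern comprVar  = inj₁ zero
pattern expT      = inj₁ (suc zero)
pattern end       = inj₁ (suc (suc zero))
pattern col z     = inj₂ (inj₁ z)
pattern conn i f  = inj₂ (inj₂ (inj₁ (i , f)))
pattern closeF f  = inj₂ (inj₂ (inj₂ (inj₁ f)))
pattern closeT f  = inj₂ (inj₂ (inj₂ (inj₂ (inj₁ f))))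
pattern op i k    = inj₂ (inj₂ (inj₂ (inj₂ (inj₂ (inj₁ (i , k))))))
pattern exVar i   = inj₂ (inj₂ (inj₂ (inj₂ (inj₂ (inj₂ (inj₁ i))))))
pattern bar b     = inj₂ (inj₂ (inj₂ (inj₂ (inj₂ (inj₂ (inj₂ (inj₁ b)))))))
pattern expF i    = inj₂ (inj₂ (inj₂ (inj₂ (inj₂ (inj₂ (inj₂ (inj₂ i)))))))

pattern retF f = inj₁ f
pattern retT k = inj₂ k

pattern goalT        = inj₁ tt
pattern goalF z      = inj₂ (inj₁ z)
pattern negF i       = inj₂ (inj₂ (inj₁ i))
pattern parenF i     = inj₂ (inj₂ (inj₂ (inj₁ i)))
pattern andF f       = inj₂ (inj₂ (inj₂ (inj₂ (inj₁ f))))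
pattern orF i f      = inj₂ (inj₂ (inj₂ (inj₂ (inj₂ (inj₁ (i , f))))))
pattern exF i b      = inj₂ (inj₂ (inj₂ (inj₂ (inj₂ (inj₂ (inj₁ (i , b)))))))
pattern comprF b     = inj₂ (inj₂ (inj₂ (inj₂ (inj₂ (inj₂ (inj₂ (inj₁ b)))))))
pattern leftF i      = inj₂ (inj₂ (inj₂ (inj₂ (inj₂ (inj₂ (inj₂ (inj₂ (inj₁ i))))))))
pattern rightF i o k = inj₂ (inj₂ (inj₂ (inj₂ (inj₂ (inj₂ (inj₂ (inj₂ (inj₂ (i , o , k)))))))))

-- The first symbol fixes the production up to the choice of connective or of atomic predicate,
-- which `parenF` and `leftF` postpone until the first part has returned. The bottom frame `goalF z`
-- adds X ⊆ Fv φ, about which the demand is silent; for `formula` its bits are `none` and the check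
-- is vacuous.
read : Goal → Reading → Letter → Bits → Maybe ((Reading ⊎ Popping) × Maybe Frame)
read g       (col z)    𝕧  b = just (inj₁ (col (z ⊔ b)) , nothing)
read term    (col z)    #  b = just (inj₁ expT , just goalT)
read formula (col z)    #  b = just (inj₁ (expF free) , just (goalF none))
read safe    (col z)    #  b = just (inj₁ (expF (bound z)) , just (goalF z))
read g       expT       𝕧  b = just (inj₂ (retT (true , b)) , nothing)
read g       expT       ⟦ˡ b = just (inj₁ comprVar , nothing)
read g       comprVar   𝕧  b = just (inj₁ (bar b) , nothing)
read g       (bar b)    ∣ˡ _ = just (inj₁ (expF (bound b)) , just (comprF b))
read g       (closeT f) ⟧ˡ b = just (inj₂ (retT (false , f)) , nothing)
read g       (expF i)   𝕧  b = just (inj₂ (retT (true , b)) , just (leftF i))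
read g       (expF i)   ⟦ˡ b = just (inj₁ comprVar , just (leftF i))
read g       (expF i)   ¬ˡ b = just (inj₁ (expF (update (λ _ → none) i)) , just (negF i))
read g       (expF i)   ⟨ˡ b = just (inj₁ (expF i) , just (parenF i))
read g       (expF i)   ∃ˡ b = just (inj₁ (exVar i) , nothing)
read g       (op i k)   =ˡ b = just (inj₁ expT , just (rightF i ≐ᵒ k))
read g       (op i k)   ∈ˡ b = just (inj₁ expT , just (rightF i ∈ᵒ k))
read g       (conn i f) ∧ˡ b = just (inj₁ (expF (update (_⊖ f) i)) , just (andF f))
read g       (conn i f) ∨ˡ b = just (inj₁ (expF i) , just (orF i f))
read g       (closeF f) ⟩ˡ b = just (inj₂ (retF f) , nothing)
read g       (exVar i)  𝕧  b = just (inj₁ (expF (update (_⊔ b) i)) , just (exF i b))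
read g       _          _  b = nothing

guard : Bool → Reading ⊎ Popping → Maybe (Reading ⊎ Popping)
guard b c = if b then just c else nothing

pop : Popping → Frame → Maybe (Reading ⊎ Popping)
pop (retF f) (goalF z)      = guard (bind-ok z f) (inj₁ end)
pop (retF f) (negF i)       = guard (demand i (λ z → disjoint-ok z f)) (inj₂ (retF f))
pop (retF f) (parenF i)     = just (inj₁ (conn i f))
pop (retF g) (andF f)       = just (inj₁ (closeF (f ⊔ g)))
pop (retF g) (orF i f)      = guard (demand i (or-ok f g)) (inj₁ (closeF (f ⊔ g)))
pop (retF f) (exF i b)      = guard (demand i (λ _ → bind-ok b f)) (inj₂ (retF (f ⊖ b)))
pop (retF f) (comprF b)     = guard (bind-ok b f) (inj₁ (closeT (f ⊖ b)))
pop (retT k) goalT          = just (inj₁ end)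
pop (retT k) (leftF i)      = just (inj₁ (op i k))
pop (retT l) (rightF i o k) = guard (demand i (atom-ok o k l)) (inj₂ (retF (proj₂ k ⊔ proj₂ l)))
pop _        _              = nothing

accepting : Reading → Bool
accepting end = true
accepting _   = false

automaton : Goal → PDA
automaton g = record
  { Reading = Reading ; Popping = Popping ; Frame = Frame
  ; opening = col none ; read = read g ; pop = pop ; accepting = accepting }

-- The test on syntax trees, and its agreement with the automaton

isVar : PreTerm → Bool
isVar (var _)     = true
isVar (compr _ _) = false

freeT : Var → PreTerm → Bool
freeF : Var → PreFormula → Bool
freeT x (var z)     = does (z ℕᵇ.≟ x)
freeT x (compr z φ) = freeF x φ ∧ not (does (z ℕᵇ.≟ x))
freeF x (t ≐ s)     = freeT x t ∨ freeT x s
freeF x (t ∈̇ s)     = freeT x t ∨ freeT x s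
freeF x (¬̇ φ)       = freeF x φ
freeF x (φ ∧̇ ψ)     = freeF x φ ∨ freeF x ψ
freeF x (φ ∨̇ ψ)     = freeF x φ ∨ freeF x ψ
freeF x (∃̇ z φ)     = freeF x φ ∧ not (does (z ℕᵇ.≟ x))

module Check (x y : Var) where

  bit : Var → Bits
  bit z = does (z ℕᵇ.≟ x) , does (z ℕᵇ.≟ y)

  fvT : PreTerm → Bits
  fvT t = freeT x t , freeT y t

  fvF : PreFormula → Bits
  fvF φ = freeF x φ , freeF y φ

  kind : PreTerm → Kind
  kind t = isVar t , fvT t

  -- The demand `free` is weaker than `bound none`: safety for the empty set still asks a quantified
  -- body to be safe for its bound variable, which being a formula does not.
  okT : PreTerm → Bool
  okF : Demand → PreFormula → Bool
  okT (var z)     = true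
  okT (compr z φ) = okF (bound (bit z)) φ ∧ bind-ok (bit z) (fvF φ)
  okF i (t ≐ s)   = okT t ∧ okT s ∧ demand i (atom-ok ≐ᵒ (kind t) (kind s))
  okF i (t ∈̇ s)   = okT t ∧ okT s ∧ demand i (atom-ok ∈ᵒ (kind t) (kind s))
  okF i (¬̇ φ)     = okF (update (λ _ → none) i) φ ∧ demand i (λ z → disjoint-ok z (fvF φ))
  okF i (φ ∧̇ ψ)   = okF i φ ∧ okF (update (_⊖ fvF φ) i) ψ
  okF i (φ ∨̇ ψ)   = okF i φ ∧ okF i ψ ∧ demand i (or-ok (fvF φ) (fvF ψ))
  okF i (∃̇ z φ)   = okF (update (_⊔ bit z) i) φ ∧ demand i (λ _ → bind-ok (bit z) (fvF φ))

  module _ (g : Goal) where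

    open Runs (automaton g) x y

    guard-accepts : ∀ b c fs ts → reduce (guard b c) fs ts ≡ b ∧ accepts c fs ts
    guard-accepts true  c fs ts = refl
    guard-accepts false c fs ts = refl

    infixr 5 _⌢_
    _⌢_ : Expr → List Token → List Token
    E ⌢ ts = map just E ++ ts

    ⌢-++ : ∀ E E′ ts → (E ++ E′) ⌢ ts ≡ E ⌢ E′ ⌢ ts
    ⌢-++ E E′ ts = trans (cong (_++ ts) (map-++ just E E′)) (++-assoc (map just E) (map just E′) ts)

    -- The arbitrary stack and remaining input let the equation be iterated over subexpressions.
    -- Being an equation of Booleans, it serves soundness and completeness alike.
    accepts-term : ∀ t fs ts →
      accepts (inj₁ expT) fs (writeT t ⌢ ts) ≡ okT t ∧ accepts (inj₂ (retT (kind t))) fs ts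
    accepts-formula : ∀ φ i fs ts →
      accepts (inj₁ (expF i)) fs (write φ ⌢ ts) ≡ okF i φ ∧ accepts (inj₂ (retF (fvF φ))) fs ts

    accepts-term (var z)     fs ts = refl
    accepts-term (compr z φ) fs ts = begin
      accepts (inj₁ expT) fs (writeT (compr z φ) ⌢ ts)
        ≡⟨ cong (accepts (inj₁ (expF (bound (bit z)))) (comprF (bit z) ∷ fs)) (⌢-++ (write φ) [ `⟧ ] ts) ⟩
      accepts (inj₁ (expF (bound (bit z)))) (comprF (bit z) ∷ fs) (write φ ⌢ just `⟧ ∷ ts)
        ≡⟨ accepts-formula φ (bound (bit z)) (comprF (bit z) ∷ fs) (just `⟧ ∷ ts) ⟩
      okF (bound (bit z)) φ ∧ reduce (guard (bind-ok (bit z) (fvF φ)) (inj₁ (closeT (fvF φ ⊖ bit z)))) fs (just `⟧ ∷ ts)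
        ≡⟨ cong (okF (bound (bit z)) φ ∧_) (guard-accepts (bind-ok (bit z) (fvF φ)) _ fs _) ⟩
      okF (bound (bit z)) φ ∧ bind-ok (bit z) (fvF φ) ∧ accepts (inj₂ (retT (kind (compr z φ)))) fs ts
        ≡⟨ ∧-assoc (okF (bound (bit z)) φ) _ _ ⟨
      okT (compr z φ) ∧ accepts (inj₂ (retT (kind (compr z φ)))) fs ts ∎
      where open ≡-Reasoning

    -- A formula that begins like a term is atomic, so `expF` may commit itself at the first symbol.
    accepts-left : ∀ t i fs ts →
      accepts (inj₁ (expF i)) fs (writeT t ⌢ ts) ≡ accepts (inj₁ expT) (leftF i ∷ fs) (writeT t ⌢ ts)
    accepts-left (var z)     i fs ts = refl
    accepts-left (compr z φ) i fs ts = refl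

    accepts-atom : ∀ o l t s i fs ts →
      (∀ k us → accepts (inj₁ (op i k)) fs (just l ∷ us) ≡ accepts (inj₁ expT) (rightF i o k ∷ fs) us) →
      accepts (inj₁ (expF i)) fs ((writeT t ++ l ∷ writeT s) ⌢ ts) ≡
      (okT t ∧ okT s ∧ demand i (atom-ok o (kind t) (kind s))) ∧ accepts (inj₂ (retF (fvT t ⊔ fvT s))) fs ts
    accepts-atom o l t s i fs ts opₗ = begin
      accepts (inj₁ (expF i)) fs ((writeT t ++ l ∷ writeT s) ⌢ ts)
        ≡⟨ cong (accepts (inj₁ (expF i)) fs) (⌢-++ (writeT t) (l ∷ writeT s) ts) ⟩
      accepts (inj₁ (expF i)) fs (writeT t ⌢ just l ∷ writeT s ⌢ ts)
        ≡⟨ accepts-left t i fs _ ⟩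
      accepts (inj₁ expT) (leftF i ∷ fs) (writeT t ⌢ just l ∷ writeT s ⌢ ts)
        ≡⟨ accepts-term t (leftF i ∷ fs) _ ⟩
      okT t ∧ accepts (inj₁ (op i (kind t))) fs (just l ∷ writeT s ⌢ ts)
        ≡⟨ cong (okT t ∧_) (trans (opₗ (kind t) _) (accepts-term s _ ts)) ⟩
      okT t ∧ okT s ∧ reduce (guard (demand i (atom-ok o (kind t) (kind s))) (inj₂ (retF (fvT t ⊔ fvT s)))) fs ts
        ≡⟨ cong (λ b → okT t ∧ okT s ∧ b) (guard-accepts (demand i (atom-ok o (kind t) (kind s))) _ fs ts) ⟩
      okT t ∧ okT s ∧ demand i (atom-ok o (kind t) (kind s)) ∧ accepts (inj₂ (retF (fvT t ⊔ fvT s))) fs ts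
        ≡⟨ cong (okT t ∧_) (∧-assoc (okT s) _ _) ⟨
      okT t ∧ (okT s ∧ demand i (atom-ok o (kind t) (kind s))) ∧ accepts (inj₂ (retF (fvT t ⊔ fvT s))) fs ts
        ≡⟨ ∧-assoc (okT t) _ _ ⟨
      (okT t ∧ okT s ∧ demand i (atom-ok o (kind t) (kind s))) ∧ accepts (inj₂ (retF (fvT t ⊔ fvT s))) fs ts ∎
      where open ≡-Reasoning

    accepts-formula (t ≐ s) i fs ts = accepts-atom ≐ᵒ `= t s i fs ts (λ _ _ → refl)
    accepts-formula (t ∈̇ s) i fs ts = accepts-atom ∈ᵒ `∈ t s i fs ts (λ _ _ → refl)
    accepts-formula (¬̇ φ) i fs ts = begin
      accepts (inj₁ (expF i′)) (negF i ∷ fs) (write φ ⌢ ts)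
        ≡⟨ accepts-formula φ i′ (negF i ∷ fs) ts ⟩
      okF i′ φ ∧ reduce (guard d (inj₂ (retF (fvF φ)))) fs ts
        ≡⟨ cong (okF i′ φ ∧_) (guard-accepts d _ fs ts) ⟩
      okF i′ φ ∧ d ∧ accepts (inj₂ (retF (fvF φ))) fs ts
        ≡⟨ ∧-assoc (okF i′ φ) _ _ ⟨
      okF i (¬̇ φ) ∧ accepts (inj₂ (retF (fvF φ))) fs ts ∎
      where
      open ≡-Reasoning
      i′ = update (λ _ → none) i
      d  = demand i (λ z → disjoint-ok z (fvF φ))
    accepts-formula (φ ∧̇ ψ) i fs ts = begin
      accepts (inj₁ (expF i)) (parenF i ∷ fs) ((write φ ++ `∧ ∷ write ψ ++ [ `⟩ ]) ⌢ ts)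
        ≡⟨ cong (accepts (inj₁ (expF i)) (parenF i ∷ fs))
             (trans (⌢-++ (write φ) _ ts) (cong (λ us → write φ ⌢ just `∧ ∷ us) (⌢-++ (write ψ) [ `⟩ ] ts))) ⟩
      accepts (inj₁ (expF i)) (parenF i ∷ fs) (write φ ⌢ just `∧ ∷ write ψ ⌢ just `⟩ ∷ ts)
        ≡⟨ accepts-formula φ i (parenF i ∷ fs) _ ⟩
      okF i φ ∧ accepts (inj₁ (expF i′)) (andF (fvF φ) ∷ fs) (write ψ ⌢ just `⟩ ∷ ts)
        ≡⟨ cong (okF i φ ∧_) (accepts-formula ψ i′ (andF (fvF φ) ∷ fs) _) ⟩
      okF i φ ∧ okF i′ ψ ∧ accepts (inj₂ (retF (fvF (φ ∧̇ ψ)))) fs ts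
        ≡⟨ ∧-assoc (okF i φ) _ _ ⟨
      okF i (φ ∧̇ ψ) ∧ accepts (inj₂ (retF (fvF (φ ∧̇ ψ)))) fs ts ∎
      where
      open ≡-Reasoning
      i′ = update (_⊖ fvF φ) i
    accepts-formula (φ ∨̇ ψ) i fs ts = begin
      accepts (inj₁ (expF i)) (parenF i ∷ fs) ((write φ ++ `∨ ∷ write ψ ++ [ `⟩ ]) ⌢ ts)
        ≡⟨ cong (accepts (inj₁ (expF i)) (parenF i ∷ fs))
             (trans (⌢-++ (write φ) _ ts) (cong (λ us → write φ ⌢ just `∨ ∷ us) (⌢-++ (write ψ) [ `⟩ ] ts))) ⟩
      accepts (inj₁ (expF i)) (parenF i ∷ fs) (write φ ⌢ just `∨ ∷ write ψ ⌢ just `⟩ ∷ ts)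
        ≡⟨ accepts-formula φ i (parenF i ∷ fs) _ ⟩
      okF i φ ∧ accepts (inj₁ (expF i)) (orF i (fvF φ) ∷ fs) (write ψ ⌢ just `⟩ ∷ ts)
        ≡⟨ cong (okF i φ ∧_) (accepts-formula ψ i (orF i (fvF φ) ∷ fs) _) ⟩
      okF i φ ∧ okF i ψ ∧ reduce (guard d (inj₁ (closeF (fvF (φ ∨̇ ψ))))) fs (just `⟩ ∷ ts)
        ≡⟨ cong (λ b → okF i φ ∧ okF i ψ ∧ b) (guard-accepts d _ fs _) ⟩
      okF i φ ∧ okF i ψ ∧ d ∧ accepts (inj₂ (retF (fvF (φ ∨̇ ψ)))) fs ts
        ≡⟨ cong (okF i φ ∧_) (∧-assoc (okF i ψ) _ _) ⟨
      okF i φ ∧ (okF i ψ ∧ d) ∧ accepts (inj₂ (retF (fvF (φ ∨̇ ψ)))) fs ts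
        ≡⟨ ∧-assoc (okF i φ) _ _ ⟨
      okF i (φ ∨̇ ψ) ∧ accepts (inj₂ (retF (fvF (φ ∨̇ ψ)))) fs ts ∎
      where
      open ≡-Reasoning
      d = demand i (or-ok (fvF φ) (fvF ψ))
    accepts-formula (∃̇ z φ) i fs ts = begin
      accepts (inj₁ (expF i′)) (exF i (bit z) ∷ fs) (write φ ⌢ ts)
        ≡⟨ accepts-formula φ i′ (exF i (bit z) ∷ fs) ts ⟩
      okF i′ φ ∧ reduce (guard d (inj₂ (retF (fvF (∃̇ z φ))))) fs ts
        ≡⟨ cong (okF i′ φ ∧_) (guard-accepts d _ fs ts) ⟩
      okF i′ φ ∧ d ∧ accepts (inj₂ (retF (fvF (∃̇ z φ)))) fs ts
        ≡⟨ ∧-assoc (okF i′ φ) _ _ ⟨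
      okF i (∃̇ z φ) ∧ accepts (inj₂ (retF (fvF (∃̇ z φ)))) fs ts ∎
      where
      open ≡-Reasoning
      i′ = update (_⊔ bit z) i
      d  = demand i (λ _ → bind-ok (bit z) (fvF φ))

    -- The strings that complete a run which has just read a formula (AfterF) or a term
    -- (AfterT), or is about to read something (Ahead), with a given stack.
    AfterF AfterT : List Frame → Expr → Set
    AfterF (goalF _ ∷ _)    E = E ≡ []
    AfterF (negF _ ∷ fs)    E = AfterF fs E
    AfterF (parenF _ ∷ fs)  E =
      ∃[ ψ ] ∃[ r ] (E ≡ `∧ ∷ write ψ ++ `⟩ ∷ r ⊎ E ≡ `∨ ∷ write ψ ++ `⟩ ∷ r) × AfterF fs r
    AfterF (andF _ ∷ fs)    E = ∃[ r ] E ≡ `⟩ ∷ r × AfterF fs r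
    AfterF (orF _ _ ∷ fs)   E = ∃[ r ] E ≡ `⟩ ∷ r × AfterF fs r
    AfterF (exF _ _ ∷ fs)   E = AfterF fs E
    AfterF (comprF _ ∷ fs)  E = ∃[ r ] E ≡ `⟧ ∷ r × AfterT fs r
    AfterF _                E = ⊥
    AfterT (goalT ∷ _)      E = E ≡ []
    AfterT (leftF _ ∷ fs)   E =
      ∃[ t ] ∃[ r ] (E ≡ `= ∷ writeT t ++ r ⊎ E ≡ `∈ ∷ writeT t ++ r) × AfterF fs r
    AfterT (rightF _ _ _ ∷ fs) E = AfterF fs E
    AfterT _                E = ⊥

    Ahead : Reading ⊎ Popping → List Frame → Expr → Set
    Ahead (inj₁ comprVar)   fs E = ∃[ z ] ∃[ φ ] ∃[ r ] E ≡ var z ∷ `∣ ∷ write φ ++ `⟧ ∷ r × AfterT fs r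
    Ahead (inj₁ expT)       fs E = ∃[ t ] ∃[ r ] E ≡ writeT t ++ r × AfterT fs r
    Ahead (inj₁ end)        fs E = E ≡ []
    Ahead (inj₁ (col _))    fs E = ⊤
    Ahead (inj₁ (conn i f)) fs E = AfterF (parenF i ∷ fs) E
    Ahead (inj₁ (closeF f)) fs E = AfterF (andF f ∷ fs) E
    Ahead (inj₁ (closeT f)) fs E = AfterF (comprF f ∷ fs) E
    Ahead (inj₁ (op i k))   fs E = AfterT (leftF i ∷ fs) E
    Ahead (inj₁ (exVar i))  fs E = ∃[ z ] ∃[ φ ] ∃[ r ] E ≡ var z ∷ write φ ++ r × AfterF fs r
    Ahead (inj₁ (bar b))    fs E = ∃[ φ ] ∃[ r ] E ≡ `∣ ∷ write φ ++ `⟧ ∷ r × AfterT fs r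
    Ahead (inj₁ (expF i))   fs E = ∃[ φ ] ∃[ r ] E ≡ write φ ++ r × AfterF fs r
    Ahead (inj₂ (retF _))   fs E = AfterF fs E
    Ahead (inj₂ (retT _))   fs E = AfterT fs E

    atomic-ahead : ∀ t i fs E → AfterT (leftF i ∷ fs) E → ∃[ φ ] ∃[ r ] writeT t ++ E ≡ write φ ++ r × AfterF fs r
    atomic-ahead t i fs E (s , r , inj₁ refl , a) = t ≐ s , r , sym (++-assoc (writeT t) (`= ∷ writeT s) r) , a
    atomic-ahead t i fs E (s , r , inj₂ refl , a) = t ∈̇ s , r , sym (++-assoc (writeT t) (`∈ ∷ writeT s) r) , a

    paren-ahead : ∀ φ i fs E → AfterF (parenF i ∷ fs) E → ∃[ χ ] ∃[ r ] `⟨ ∷ write φ ++ E ≡ write χ ++ r × AfterF fs r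
    paren-ahead φ i fs E (ψ , r , inj₁ refl , a) = φ ∧̇ ψ , r ,
      sym (cong (`⟨ ∷_) (trans (++-assoc (write φ) _ r) (cong (λ E → write φ ++ `∧ ∷ E) (++-assoc (write ψ) [ `⟩ ] r)))) , a
    paren-ahead φ i fs E (ψ , r , inj₂ refl , a) = φ ∨̇ ψ , r ,
      sym (cong (`⟨ ∷_) (trans (++-assoc (write φ) _ r) (cong (λ E → write φ ++ `∨ ∷ E) (++-assoc (write ψ) [ `⟩ ] r)))) , a

    compr-++ : ∀ z φ r → `⟦ ∷ var z ∷ `∣ ∷ write φ ++ `⟧ ∷ r ≡ writeT (compr z φ) ++ r
    compr-++ z φ r = cong (λ E → `⟦ ∷ var z ∷ `∣ ∷ E) (sym (++-assoc (write φ) [ `⟧ ] r))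

    guard-true : ∀ b {c fs ts} → reduce (guard b c) fs ts ≡ true → accepts c fs ts ≡ true
    guard-true true p = p

    -- Recursion on the remaining word, then on the stack. The bits are ignored, so one accepted
    -- pair already yields a syntax tree.
    parse : ∀ c fs E → accepts c fs (map just E) ≡ true → Ahead c fs E
    parse (inj₁ comprVar) fs (var z ∷ E) p with parse (inj₁ (bar (bit z))) fs E p
    ... | φ , r , refl , a = z , φ , r , refl , a
    parse (inj₁ expT) fs (var z ∷ E) p = var z , E , refl , parse (inj₂ (retT (true , bit z))) fs E p
    parse (inj₁ expT) fs (`⟦ ∷ E) p with parse (inj₁ comprVar) fs E p
    ... | z , φ , r , refl , a = compr z φ , r , compr-++ z φ r , a
    parse (inj₁ end) fs [] p = refl
    parse (inj₁ (col _)) fs E p = tt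
    parse (inj₁ (conn i f)) fs (`∧ ∷ E) p with parse (inj₁ (expF (update (_⊖ f) i))) (andF f ∷ fs) E p
    ... | ψ , _ , refl , r , refl , a = ψ , r , inj₁ refl , a
    parse (inj₁ (conn i f)) fs (`∨ ∷ E) p with parse (inj₁ (expF i)) (orF i f ∷ fs) E p
    ... | ψ , _ , refl , r , refl , a = ψ , r , inj₂ refl , a
    parse (inj₁ (closeF f)) fs (`⟩ ∷ E) p = E , refl , parse (inj₂ (retF f)) fs E p
    parse (inj₁ (closeT f)) fs (`⟧ ∷ E) p = E , refl , parse (inj₂ (retT (false , f))) fs E p
    parse (inj₁ (op i k)) fs (`= ∷ E) p with parse (inj₁ expT) (rightF i ≐ᵒ k ∷ fs) E p
    ... | t , r , refl , a = t , r , inj₁ refl , a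
    parse (inj₁ (op i k)) fs (`∈ ∷ E) p with parse (inj₁ expT) (rightF i ∈ᵒ k ∷ fs) E p
    ... | t , r , refl , a = t , r , inj₂ refl , a
    parse (inj₁ (exVar i)) fs (var z ∷ E) p with parse (inj₁ (expF (update (_⊔ bit z) i))) (exF i (bit z) ∷ fs) E p
    ... | φ , r , refl , a = z , φ , r , refl , a
    parse (inj₁ (bar b)) fs (`∣ ∷ E) p with parse (inj₁ (expF (bound b))) (comprF b ∷ fs) E p
    ... | φ , _ , refl , r , refl , a = φ , r , refl , a
    parse (inj₁ (expF i)) fs (var z ∷ E) p =
      atomic-ahead (var z) i fs E (parse (inj₂ (retT (true , bit z))) (leftF i ∷ fs) E p)
    parse (inj₁ (expF i)) fs (`⟦ ∷ E) p with parse (inj₁ comprVar) (leftF i ∷ fs) E p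
    ... | z , φ , r , refl , a with atomic-ahead (compr z φ) i fs r a
    ... | χ , r′ , e , a′ = χ , r′ , trans (compr-++ z φ r) e , a′
    parse (inj₁ (expF i)) fs (`¬ ∷ E) p with parse (inj₁ (expF (update (λ _ → none) i))) (negF i ∷ fs) E p
    ... | φ , r , refl , a = ¬̇ φ , r , refl , a
    parse (inj₁ (expF i)) fs (`⟨ ∷ E) p with parse (inj₁ (expF i)) (parenF i ∷ fs) E p
    ... | φ , r , refl , a = paren-ahead φ i fs r a
    parse (inj₁ (expF i)) fs (`∃ ∷ E) p with parse (inj₁ (exVar i)) fs E p
    ... | z , φ , r , refl , a = ∃̇ z φ , r , refl , a
    parse (inj₂ (retF f)) (goalF z ∷ fs)     E p = parse (inj₁ end) fs E (guard-true (bind-ok z f) p)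
    parse (inj₂ (retF f)) (negF i ∷ fs)      E p = parse (inj₂ (retF f)) fs E (guard-true (demand i (λ z → disjoint-ok z f)) p)
    parse (inj₂ (retF f)) (parenF i ∷ fs)    E p = parse (inj₁ (conn i f)) fs E p
    parse (inj₂ (retF g)) (andF f ∷ fs)      E p = parse (inj₁ (closeF (f ⊔ g))) fs E p
    parse (inj₂ (retF g)) (orF i f ∷ fs)     E p = parse (inj₁ (closeF (f ⊔ g))) fs E (guard-true (demand i (or-ok f g)) p)
    parse (inj₂ (retF f)) (exF i b ∷ fs)     E p = parse (inj₂ (retF (f ⊖ b))) fs E (guard-true (demand i (λ _ → bind-ok b f)) p)
    parse (inj₂ (retF f)) (comprF b ∷ fs)    E p = parse (inj₁ (closeT (f ⊖ b))) fs E (guard-true (bind-ok b f) p)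
    parse (inj₂ (retT k)) (goalT ∷ fs)       E p = parse (inj₁ end) fs E p
    parse (inj₂ (retT k)) (leftF i ∷ fs)     E p = parse (inj₁ (op i k)) fs E p
    parse (inj₂ (retT l)) (rightF i o k ∷ fs) E p =
      parse (inj₂ (retF (proj₂ k ⊔ proj₂ l))) fs E (guard-true (demand i (atom-ok o k l)) p)

-- Correctness of the test for pairs of variables

∧-true : ∀ {a b} → a ∧ b ≡ true → a ≡ true × b ≡ true
∧-true {true} {true} _ = refl , refl

∧-true⁺ : ∀ {a b} → a ≡ true → b ≡ true → a ∧ b ≡ true
∧-true⁺ refl refl = refl

∨-true : ∀ {a b} → a ∨ b ≡ true → a ≡ true ⊎ b ≡ true
∨-true {true}  _ = inj₁ refl
∨-true {false} e = inj₂ e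

true≢false : ∀ {A : Set} {a} → a ≡ true → a ≡ false → A
true≢false refl ()

≟-refl : ∀ v → does (v ℕᵇ.≟ v) ≡ true
≟-refl v with v ℕᵇ.≟ v
... | yes _ = refl
... | no ≢  = ⊥-elim (≢ refl)

≟-true : ∀ {z v} → does (z ℕᵇ.≟ v) ≡ true → z ≡ v
≟-true {z} {v} e with z ℕᵇ.≟ v
... | yes p = p

_∈ᵇ_ : Var → FinSet → Bool
v ∈ᵇ []      = false
v ∈ᵇ (z ∷ X) = does (z ℕᵇ.≟ v) ∨ v ∈ᵇ X

∈⇒∈ᵇ : ∀ {v X} → v ∈ X → v ∈ᵇ X ≡ true
∈⇒∈ᵇ {v} {X = _ ∷ X} (here refl) = cong (_∨ v ∈ᵇ X) (≟-refl v)
∈⇒∈ᵇ {v} {X = z ∷ X} (there p)   = trans (cong (does (z ℕᵇ.≟ v) ∨_) (∈⇒∈ᵇ p)) (∨-zeroʳ _)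

∈ᵇ⇒∈ : ∀ {v} X → v ∈ᵇ X ≡ true → v ∈ X
∈ᵇ⇒∈ (z ∷ X) e with ∨-true e
... | inj₁ p = here (sym (≟-true p))
... | inj₂ p = there (∈ᵇ⇒∈ X p)

∉⇒∈ᵇ : ∀ {v X} → v ∉ X → v ∈ᵇ X ≡ false
∉⇒∈ᵇ {v} {X} v∉ with v ∈ᵇ X in e
... | false = refl
... | true  = ⊥-elim (v∉ (∈ᵇ⇒∈ X e))

≡ᵇ : ∀ {a b} → (a ≡ true → b ≡ true) → (b ≡ true → a ≡ true) → a ≡ b
≡ᵇ {true}  {b}     f g = sym (f refl)
≡ᵇ {false} {true}  f g = g refl
≡ᵇ {false} {false} f g = refl

∈ᵇ-cong : ∀ {X Y} → X ∼[ set ] Y → ∀ v → v ∈ᵇ X ≡ v ∈ᵇ Y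
∈ᵇ-cong {X} {Y} X∼Y v = ≡ᵇ (∈⇒∈ᵇ ∘ Equivalence.to X∼Y ∘ ∈ᵇ⇒∈ X) (∈⇒∈ᵇ ∘ Equivalence.from X∼Y ∘ ∈ᵇ⇒∈ Y)

∈ᵇ-set : ∀ {X Y} → (∀ v → v ∈ᵇ X ≡ v ∈ᵇ Y) → X ∼[ set ] Y
∈ᵇ-set {X} {Y} e {v} = mk⇔ (λ p → ∈ᵇ⇒∈ Y (trans (sym (e v)) (∈⇒∈ᵇ p))) (λ p → ∈ᵇ⇒∈ X (trans (e v) (∈⇒∈ᵇ p)))

∈ᵇ-++ : ∀ v X Y → v ∈ᵇ (X ++ Y) ≡ v ∈ᵇ X ∨ v ∈ᵇ Y
∈ᵇ-++ v []      Y = refl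
∈ᵇ-++ v (z ∷ X) Y = trans (cong (does (z ℕᵇ.≟ v) ∨_) (∈ᵇ-++ v X Y)) (sym (∨-assoc (does (z ℕᵇ.≟ v)) _ _))

∈ᵇ-filter : ∀ p v X → v ∈ᵇ filterᵇ p X ≡ p v ∧ v ∈ᵇ X
∈ᵇ-filter p v []      = sym (∧-zeroʳ (p v))
∈ᵇ-filter p v (z ∷ X) with p z in e | z ℕᵇ.≟ v in e′
... | true  | yes refl rewrite e′ | e = refl
... | true  | no _     rewrite e′ = ∈ᵇ-filter p v X
... | false | yes refl rewrite e = trans (∈ᵇ-filter p v X) (cong (_∧ _) e)
... | false | no _     = ∈ᵇ-filter p v X

∈ᵇ-∖ : ∀ v X z → v ∈ᵇ (X ∖ z) ≡ v ∈ᵇ X ∧ not (does (z ℕᵇ.≟ v))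
∈ᵇ-∖ v []      z = refl
∈ᵇ-∖ v (a ∷ X) z with a ℕᵇ.≟ z
... | yes refl with a ℕᵇ.≟ v in e
...   | yes refl = trans (∈ᵇ-∖ v X z) (trans (cong (λ d → v ∈ᵇ X ∧ not (does d)) e) (∧-zeroʳ _))
...   | no _     = trans (∈ᵇ-∖ v X z) (cong (λ d → v ∈ᵇ X ∧ not (does d)) e)
∈ᵇ-∖ v (a ∷ X) z | no a≢z with a ℕᵇ.≟ v
...   | no _     = ∈ᵇ-∖ v X z
...   | yes refl with z ℕᵇ.≟ v
...     | yes refl = ⊥-elim (a≢z refl)
...     | no _     = refl

freeT-∈ᵇ : ∀ v t → freeT v t ≡ v ∈ᵇ FvT t
freeF-∈ᵇ : ∀ v φ → freeF v φ ≡ v ∈ᵇ Fv φ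
freeT-∈ᵇ v (var z)     = sym (∨-identityʳ _)
freeT-∈ᵇ v (compr z φ) = trans (cong (_∧ _) (freeF-∈ᵇ v φ)) (sym (∈ᵇ-∖ v (Fv φ) z))
freeF-∈ᵇ v (t ≐ s)     = trans (cong₂ _∨_ (freeT-∈ᵇ v t) (freeT-∈ᵇ v s)) (sym (∈ᵇ-++ v (FvT t) (FvT s)))
freeF-∈ᵇ v (t ∈̇ s)     = trans (cong₂ _∨_ (freeT-∈ᵇ v t) (freeT-∈ᵇ v s)) (sym (∈ᵇ-++ v (FvT t) (FvT s)))
freeF-∈ᵇ v (¬̇ φ)       = freeF-∈ᵇ v φ
freeF-∈ᵇ v (φ ∧̇ ψ)     = trans (cong₂ _∨_ (freeF-∈ᵇ v φ) (freeF-∈ᵇ v ψ)) (sym (∈ᵇ-++ v (Fv φ) (Fv ψ)))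
freeF-∈ᵇ v (φ ∨̇ ψ)     = trans (cong₂ _∨_ (freeF-∈ᵇ v φ) (freeF-∈ᵇ v ψ)) (sym (∈ᵇ-++ v (Fv φ) (Fv ψ)))
freeF-∈ᵇ v (∃̇ z φ)     = trans (cong (_∧ _) (freeF-∈ᵇ v φ)) (sym (∈ᵇ-∖ v (Fv φ) z))

-- Induction on the derivation: ∃ removes the same variable from the safe set and from the free
-- variables.
≻-free : ∀ {φ X} → φ ≻ X → ∀ v → v ∈ᵇ X ≡ true → freeF v φ ≡ true
≻-free (self {x})       v e = trans (cong (_∨ does (x ℕᵇ.≟ v)) (trans (sym (∨-identityʳ _)) e)) refl
≻-free (eqˡ {x} {t} _ _) v e = trans (cong (_∨ freeT v t) (trans (sym (∨-identityʳ _)) e)) refl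
≻-free (eqʳ {x} {t} _ _) v e = trans (cong (freeT v t ∨_) (trans (sym (∨-identityʳ _)) e)) (∨-zeroʳ _)
≻-free (mem {x} {t} _ _) v e = trans (cong (_∨ freeT v t) (trans (sym (∨-identityʳ _)) e)) refl
≻-free (or p q)         v e = cong (_∨ _) (≻-free p v e)
≻-free (and {φ} {ψ} {X} {Y} p q _) v e with ∨-true (trans (sym (∈ᵇ-++ v X Y)) e)
... | inj₁ e′ = cong (_∨ _) (≻-free p v e′)
... | inj₂ e′ = trans (cong (freeF v φ ∨_) (≻-free q v e′)) (∨-zeroʳ _)
≻-free (ex {y} {φ} {X} _ p) v e =
  let (e₁ , e₂) = ∧-true {v ∈ᵇ X} (trans (sym (∈ᵇ-∖ v X y)) e) in ∧-true⁺ (≻-free p v e₁) e₂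
≻-free (resp X∼Y p)     v e = ≻-free p v (trans (∈ᵇ-cong X∼Y v) e)

≻-formula : ∀ {φ X} → φ ≻ X → IsFormula φ
≻-formula (atom-≐ t s) = eq t s
≻-formula (atom-∈ t s) = mem t s
≻-formula (self {x})   = mem (var x) (var x)
≻-formula (eqˡ {x} t _) = eq (var x) t
≻-formula (eqʳ {x} t _) = eq t (var x)
≻-formula (mem {x} t _) = mem (var x) t
≻-formula (neg p)      = neg (≻-formula p)
≻-formula (or p q)     = or (≻-formula p) (≻-formula q)
≻-formula (and p q _)  = and (≻-formula p) (≻-formula q)
≻-formula (ex _ p)     = ex (≻-formula p)
≻-formula (resp _ p)   = ≻-formula p

-- In the next lemmas z stands for Z v, f and g for the freeness of v in two parts.

imp-false : ∀ {a} b → false ≡ a → a ⇒ b ≡ true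
imp-false b refl = refl

one-side-false : ∀ v v′ z z′ f f₂ g₁ g → false ≡ z ∧ (f ∨ g₁) → one-side v v′ (z , z′) (f , f₂) (g₁ , g) ≡ true
one-side-false false v′    z     z′ f     f₂ g₁ g _ = refl
one-side-false true  false z     z′ f     f₂ g₁ g _ = refl
one-side-false true  true  z     z′ false f₂ g₁ g _ = refl
one-side-false true  true  false z′ true  f₂ g₁ g _ = refl

self-ok : ∀ z f → mem-ok true true z f f ≡ true
self-ok false f     = refl
self-ok true  true  = refl
self-ok true  false = refl

left-ok : ∀ v z f g → f ∨ false ≡ z ∧ (f ∨ g) → (f ≡ true → g ≡ false) → eq-ok true v z f g ≡ true
left-ok v false f     g     h k = refl
left-ok v true  false false h k = refl
left-ok v true  true  g     h k rewrite k refl = refl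

left-one-side : ∀ v z z′ f f₂ g₁ g → f₂ ∨ false ≡ z′ ∧ (f₂ ∨ g) → (f₂ ≡ true → g ≡ false) →
  one-side true v (z , z′) (f , f₂) (g₁ , g) ≡ true
left-one-side false z     z′    f     f₂    g₁ g     h k = refl
left-one-side true  z     z′    false f₂    g₁ g     h k = refl
left-one-side true  false z′    true  f₂    g₁ g     h k = refl
left-one-side true  true  z′    true  f₂    g₁ false h k = refl
left-one-side true  true  false true  f₂    g₁ true  h k = refl
left-one-side true  true  true  true  true  g₁ true  h k = sym (k refl)

right-ok : ∀ v z f g → g ∨ false ≡ z ∧ (f ∨ g) → (g ≡ true → f ≡ false) → eq-ok v true z f g ≡ true
right-ok v     false f     g     h k = refl
right-ok v     true  false false h k = refl
right-ok false true  f     true  h k rewrite k refl = refl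
right-ok true  true  f     true  h k rewrite k refl = refl

right-one-side : ∀ v z z′ f f₂ g₁ g → g₁ ∨ false ≡ z ∧ (f ∨ g₁) → (g₁ ≡ true → f ≡ false) →
  one-side v true (z , z′) (f , f₂) (g₁ , g) ≡ true
right-one-side false z     z′ f     f₂ g₁   g h k = refl
right-one-side true  z     z′ false f₂ g₁   g h k = refl
right-one-side true  false z′ true  f₂ g₁   g h k = refl
right-one-side true  true  z′ true  f₂ true g h k with () ← k refl

mem-left-ok : ∀ v z f g → f ∨ false ≡ z ∧ (f ∨ g) → (f ≡ true → g ≡ false) → mem-ok true v z f g ≡ true
mem-left-ok v false f     g     h k = refl
mem-left-ok v true  false false h k = refl
mem-left-ok v true  true  g     h k rewrite k refl = refl

or-left : ∀ w z f g → w ≡ z ∧ (f ∨ g) → (w ≡ true → f ≡ true) → w ≡ z ∧ f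
or-left w     false f     g h k = h
or-left true  true  f     g h k = sym (k refl)
or-left false true  false g h k = refl

or-right : ∀ w z f g → w ≡ z ∧ (f ∨ g) → (w ≡ true → g ≡ true) → w ≡ z ∧ g
or-right w     false f     g     h k = h
or-right true  true  f     g     h k = sym (k refl)
or-right false true  false false h k = refl

or-agree : ∀ {w a b} → w ≡ a → w ≡ b → (a ⇔ᵇ b) ≡ true
or-agree {true}  refl refl = refl
or-agree {false} refl refl = refl

-- With w and u for membership in the two sets of the conjunction rule: X ⊆ Fv φ and Y ∩ Fv φ = ∅
-- leave only one way of dividing their union.
and-left : ∀ w u z f g → w ∨ u ≡ z ∧ (f ∨ g) → (w ≡ true → f ≡ true) → (u ≡ true → f ≡ false) → w ≡ z ∧ f
and-left false u     false f     g h k l = refl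
and-left true  u     true  f     g h k l = sym (k refl)
and-left false u     true  false g h k l = refl
and-left false true  true  true  g h k l = sym (l refl)

and-right : ∀ w u z f g → w ∨ u ≡ z ∧ (f ∨ g) → (w ≡ true → f ≡ true) → (u ≡ true → f ≡ false) → u ≡ (z ∧ not f) ∧ g
and-right false u     false f     g h k l = h
and-right w     true  true  true  g h k l = l refl
and-right w     false true  true  g h k l = refl
and-right true  u     true  false g h k l with () ← k refl
and-right false u     true  false g h k l = h

ex-step : ∀ w z f b → w ∧ not b ≡ z ∧ (f ∧ not b) → (b ≡ true → w ≡ true) → (w ≡ true → f ≡ true) → w ≡ (z ∨ b) ∧ f
ex-step w     z     f true  h k l = trans (k refl) (sym (∧-true⁺ (∨-zeroʳ z) (l (k refl))))
ex-step w     z     f false h k l = trans (sym (∧-identityʳ w)) (trans h (cong₂ _∧_ (sym (∨-identityʳ z)) (∧-identityʳ f)))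

not-both : ∀ {a} → false ≡ a → not a ≡ true
not-both refl = refl

⇒-intro : ∀ a b → (a ≡ true → b ≡ true) → a ⇒ b ≡ true
⇒-intro true  b k = k refl
⇒-intro false b k = refl

⇒-elim : ∀ {a b} → a ⇒ b ≡ true → a ≡ true → b ≡ true
⇒-elim e refl = e

restrict : ∀ {b f} → (b ≡ true → f ≡ true) → b ≡ b ∧ f
restrict {true}  k = sym (k refl)
restrict {false} k = refl

free-bound : ∀ {φ z} → φ ≻ [ z ] → ∀ v → does (z ℕᵇ.≟ v) ≡ true → freeF v φ ≡ true
free-bound p v e = ≻-free p v (trans (∨-identityʳ _) e)

bind-ok-free : ∀ φ z → (∀ v → does (z ℕᵇ.≟ v) ≡ true → freeF v φ ≡ true) →
  ∀ x y → bind-ok (Check.bit x y z) (Check.fvF x y φ) ≡ true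
bind-ok-free φ z k x y = ∧-true⁺ (⇒-intro _ _ (k x)) (⇒-intro _ _ (k y))

not-free : ∀ {z} t → z ∉ FvT t → ∀ v → does (z ℕᵇ.≟ v) ≡ true → freeT v t ≡ false
not-free {z} t z∉ v e with refl ← ≟-true {z} {v} e = trans (freeT-∈ᵇ z t) (∉⇒∈ᵇ z∉)

term-ok    : ∀ {t} → IsTerm t → ∀ x y → Check.okT x y t ≡ true
formula-ok : ∀ {φ} → IsFormula φ → ∀ x y → Check.okF x y free φ ≡ true
-- `Z` is generalised to any predicate whose trace on the free variables is W, since the sets handed
-- down by `okF` agree with those in the derivation only there.
safe-ok    : ∀ {φ W} → φ ≻ W → ∀ Z → (∀ v → v ∈ᵇ W ≡ Z v ∧ freeF v φ) →
             ∀ x y → Check.okF x y (bound (Z x , Z y)) φ ≡ true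

term-ok (var z)             x y = refl
term-ok (compr {z} {φ} f p) x y = ∧-true⁺
  (safe-ok p (λ v → does (z ℕᵇ.≟ v)) (λ v → trans (∨-identityʳ _) (restrict (free-bound p v))) x y)
  (bind-ok-free φ z (free-bound p) x y)

formula-ok (eq t s)     x y = ∧-true⁺ (term-ok t x y) (∧-true⁺ (term-ok s x y) refl)
formula-ok (mem t s)    x y = ∧-true⁺ (term-ok t x y) (∧-true⁺ (term-ok s x y) refl)
formula-ok (neg f)      x y = ∧-true⁺ (formula-ok f x y) refl
formula-ok (and f g)    x y = ∧-true⁺ (formula-ok f x y) (formula-ok g x y)
formula-ok (or f g)     x y = ∧-true⁺ (formula-ok f x y) (∧-true⁺ (formula-ok g x y) refl)
formula-ok (ex f)       x y = ∧-true⁺ (formula-ok f x y) refl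

safe-ok (atom-≐ {t} {s} t✓ s✓) Z h x y = ∧-true⁺ (term-ok t✓ x y) (∧-true⁺ (term-ok s✓ x y)
  (∧-true⁺ (imp-false _ (h x)) (∧-true⁺ (imp-false _ (h y))
    (one-side-false (isVar t) (isVar s) (Z x) (Z y) (freeT x t) (freeT y t) (freeT x s) (freeT y s) (h x)))))
safe-ok (atom-∈ t✓ s✓) Z h x y = ∧-true⁺ (term-ok t✓ x y) (∧-true⁺ (term-ok s✓ x y)
  (∧-true⁺ (imp-false _ (h x)) (imp-false _ (h y))))
safe-ok (self {z}) Z h x y = ∧-true⁺ (self-ok (Z x) (does (z ℕᵇ.≟ x))) (self-ok (Z y) (does (z ℕᵇ.≟ y)))
safe-ok (eqˡ {z} {s} s✓ z∉) Z h x y = ∧-true⁺ (term-ok s✓ x y)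
  (∧-true⁺ (left-ok (isVar s) (Z x) _ (freeT x s) (h x) (not-free s z∉ x))
  (∧-true⁺ (left-ok (isVar s) (Z y) _ (freeT y s) (h y) (not-free s z∉ y))
    (left-one-side (isVar s) (Z x) (Z y) (does (z ℕᵇ.≟ x)) _ (freeT x s) (freeT y s) (h y) (not-free s z∉ y))))
safe-ok (eqʳ {z} {t} t✓ z∉) Z h x y = ∧-true⁺ (term-ok t✓ x y)
  (∧-true⁺ (right-ok (isVar t) (Z x) (freeT x t) _ (h x) (not-free t z∉ x))
  (∧-true⁺ (right-ok (isVar t) (Z y) (freeT y t) _ (h y) (not-free t z∉ y))
    (right-one-side (isVar t) (Z x) (Z y) (freeT x t) (freeT y t) _ (does (z ℕᵇ.≟ y)) (h x) (not-free t z∉ x))))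
safe-ok (mem {z} {s} s✓ z∉) Z h x y = ∧-true⁺ (term-ok s✓ x y)
  (∧-true⁺ (mem-left-ok (isVar s) (Z x) _ (freeT x s) (h x) (not-free s z∉ x))
           (mem-left-ok (isVar s) (Z y) _ (freeT y s) (h y) (not-free s z∉ y)))
safe-ok (neg p) Z h x y = ∧-true⁺ (safe-ok p (λ _ → false) (λ _ → refl) x y)
  (∧-true⁺ (not-both (h x)) (not-both (h y)))
safe-ok (or {φ} {ψ} {W} p q) Z h x y = ∧-true⁺ (safe-ok p Z l x y) (∧-true⁺ (safe-ok q Z r x y)
  (∧-true⁺ (or-agree (l x) (r x)) (or-agree (l y) (r y))))
  where
  l : ∀ v → v ∈ᵇ W ≡ Z v ∧ freeF v φ
  l v = or-left (v ∈ᵇ W) (Z v) (freeF v φ) (freeF v ψ) (h v) (≻-free p v)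
  r : ∀ v → v ∈ᵇ W ≡ Z v ∧ freeF v ψ
  r v = or-right (v ∈ᵇ W) (Z v) (freeF v φ) (freeF v ψ) (h v) (≻-free q v)
safe-ok (and {φ} {ψ} {X} {Y} p q disj) Z h x y = ∧-true⁺
  (safe-ok p Z (λ v → and-left (v ∈ᵇ X) (v ∈ᵇ Y) (Z v) (freeF v φ) (freeF v ψ) (h′ v) (≻-free p v) (apart v)) x y)
  (safe-ok q (λ v → Z v ∧ not (freeF v φ))
    (λ v → and-right (v ∈ᵇ X) (v ∈ᵇ Y) (Z v) (freeF v φ) (freeF v ψ) (h′ v) (≻-free p v) (apart v)) x y)
  where
  h′ : ∀ v → v ∈ᵇ X ∨ v ∈ᵇ Y ≡ Z v ∧ (freeF v φ ∨ freeF v ψ)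
  h′ v = trans (sym (∈ᵇ-++ v X Y)) (h v)
  apart : ∀ v → v ∈ᵇ Y ≡ true → freeF v φ ≡ false
  apart v e = trans (freeF-∈ᵇ v φ) (∉⇒∈ᵇ (λ v∈ → disj (∈ᵇ⇒∈ Y e , v∈)))
safe-ok (ex {z} {φ} {X} z∈X p) Z h x y = ∧-true⁺
  (safe-ok p (λ v → Z v ∨ does (z ℕᵇ.≟ v))
    (λ v → ex-step (v ∈ᵇ X) (Z v) (freeF v φ) (does (z ℕᵇ.≟ v)) (trans (sym (∈ᵇ-∖ v X z)) (h v)) (z∈ v) (≻-free p v)) x y)
  (bind-ok-free φ z (λ v e → ≻-free p v (z∈ v e)) x y)
  where
  z∈ : ∀ v → does (z ℕᵇ.≟ v) ≡ true → v ∈ᵇ X ≡ true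
  z∈ v e with refl ← ≟-true {z} {v} e = ∈⇒∈ᵇ z∈X
safe-ok (resp X∼Y p) Z h x y = safe-ok p Z (λ v → trans (∈ᵇ-cong X∼Y v) (h v)) x y

free-occursT : ∀ v t → freeT v t ≡ true → var v ∈ writeT t
free-occursF : ∀ v φ → freeF v φ ≡ true → var v ∈ write φ
free-occursT v (var z) e with refl ← ≟-true {z} {v} e = here refl
free-occursT v (compr z φ) e = there (there (there (∈-++⁺ˡ (free-occursF v φ (proj₁ (∧-true e))))))
free-occursF v (t ≐ s) e with ∨-true {freeT v t} e
... | inj₁ p = ∈-++⁺ˡ (free-occursT v t p)
... | inj₂ p = ∈-++⁺ʳ (writeT t) (there (free-occursT v s p))
free-occursF v (t ∈̇ s) e with ∨-true {freeT v t} e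
... | inj₁ p = ∈-++⁺ˡ (free-occursT v t p)
... | inj₂ p = ∈-++⁺ʳ (writeT t) (there (free-occursT v s p))
free-occursF v (¬̇ φ) e = there (free-occursF v φ e)
free-occursF v (φ ∧̇ ψ) e with ∨-true {freeF v φ} e
... | inj₁ p = there (∈-++⁺ˡ (free-occursF v φ p))
... | inj₂ p = there (∈-++⁺ʳ (write φ) (there (∈-++⁺ˡ (free-occursF v ψ p))))
free-occursF v (φ ∨̇ ψ) e with ∨-true {freeF v φ} e
... | inj₁ p = there (∈-++⁺ˡ (free-occursF v φ p))
... | inj₂ p = there (∈-++⁺ʳ (write φ) (there (∈-++⁺ˡ (free-occursF v ψ p))))
free-occursF v (∃̇ z φ) e = there (there (free-occursF v φ (proj₁ (∧-true e))))

only-one : ∀ {w W} → w ∈ W → (∀ v → v ∈ᵇ W ≡ true → w ≡ v) → [ w ] ∼[ set ] W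
only-one {w} {W} w∈W unique = mk⇔ (λ { (here refl) → w∈W }) (λ v∈W → here (sym (unique _ (∈⇒∈ᵇ v∈W))))

eq-ok-true : ∀ v v′ {z f g} → eq-ok v v′ z f g ≡ true → z ≡ true → f ∨ g ≡ true →
  (v ≡ true × f ≡ true × g ≡ false) ⊎ (v′ ≡ true × g ≡ true × f ≡ false)
eq-ok-true true v′   {f = true}  {false} e refl _ = inj₁ (refl , refl , refl)
eq-ok-true v    true {f = false} {true}  e refl _ = inj₂ (refl , refl , refl)
eq-ok-true false true  {f = true}  {false} () refl _
eq-ok-true false false {f = true}  {false} () refl _
eq-ok-true true  false {f = false} {true}  () refl _
eq-ok-true false false {f = false} {true}  () refl _
eq-ok-true true  true  {f = true}  {true}  () refl _
eq-ok-true true  false {f = true}  {true}  () refl _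
eq-ok-true false true  {f = true}  {true}  () refl _
eq-ok-true false false {f = true}  {true}  () refl _

one-side-true : ∀ {v v′ z z′ f f₂ g₁ g} → one-side v v′ (z , z′) (f , f₂) (g₁ , g) ≡ true →
  v ≡ true → v′ ≡ true → f ≡ true → z ≡ true → g ≡ true → z′ ≡ true → ⊥
one-side-true () refl refl refl refl refl refl

mem-ok-true : ∀ v v′ {z f g} → mem-ok v v′ z f g ≡ true → z ≡ true → f ∨ g ≡ true →
  v ≡ true × f ≡ true × (g ≡ false ⊎ v′ ≡ true)
mem-ok-true true v′   {f = true} {false} e refl _ = refl , refl , inj₁ refl
mem-ok-true true true {f = true} {true}  e refl _ = refl , refl , inj₂ refl
mem-ok-true true  v′  {f = false} {true} () refl _
mem-ok-true false v′  {f = false} {true} () refl _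

free-∉ : ∀ {w} t → freeT w t ≡ false → w ∉ FvT t
free-∉ {w} t e w∈ = true≢false (trans (freeT-∈ᵇ w t) (∈⇒∈ᵇ w∈)) e

-- From passed tests to derivations

-- Only names occurring in the input are tested, and `V` stands for these. By `free-occursF` it
-- contains every variable whose membership in Z matters.
module Complete (V : Var → Set) where

  VarsIn : Expr → Set
  VarsIn E = ∀ {z} → var z ∈ E → V z

  Restricts : FinSet → (Var → Bool) → PreFormula → Set
  Restricts W Z φ = ∀ v → v ∈ᵇ W ≡ Z v ∧ freeF v φ

  module _ {φ W Z} (vars : VarsIn (write φ)) (h : Restricts W Z φ) where

    member : ∀ v → v ∈ᵇ W ≡ true → Z v ≡ true × freeF v φ ≡ true × V v
    member v e = let (z , f) = ∧-true (trans (sym (h v)) e) in z , f , vars (free-occursF v φ f)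

  -- A nonempty W has to be a singleton. By the pairs (v , v) each member is one of the two sides;
  -- members on the same side coincide, and members on opposite sides are excluded by `one-side`.
  eq-safe : ∀ t s {W Z} → IsTerm t → IsTerm s → VarsIn (write (t ≐ s)) → Restricts W Z (t ≐ s) →
    (∀ {x y} → V x → V y → atom-ok ≐ᵒ (Check.kind x y t) (Check.kind x y s) (Z x , Z y) ≡ true) →
    t ≐ s ≻ W
  eq-safe t s {[]}    {Z} t✓ s✓ vars h ok = atom-≐ t✓ s✓
  eq-safe t s {w ∷ W} {Z} t✓ s✓ vars h ok = by-side t s t✓ s✓ (λ v e → side v e) separate (side w w∈)
    where
    w∈ : w ∈ᵇ (w ∷ W) ≡ true
    w∈ = ∈⇒∈ᵇ {X = w ∷ W} (here refl)
    Side : PreTerm → PreTerm → Var → Set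
    Side t s v = (isVar t ≡ true × freeT v t ≡ true × freeT v s ≡ false) ⊎
                 (isVar s ≡ true × freeT v s ≡ true × freeT v t ≡ false)
    Separate : PreTerm → PreTerm → Set
    Separate t s = ∀ u v → u ∈ᵇ (w ∷ W) ≡ true → v ∈ᵇ (w ∷ W) ≡ true →
      isVar t ≡ true → isVar s ≡ true → freeT u t ≡ true → freeT v s ≡ true → ⊥
    side : ∀ v → v ∈ᵇ (w ∷ W) ≡ true → Side t s v
    side v e = let (z , f , Vv) = member {t ≐ s} {w ∷ W} vars h v e in
      eq-ok-true (isVar t) (isVar s) (proj₁ (∧-true (ok Vv Vv))) z f
    separate : Separate t s
    separate u v e e′ vt vs p q =
      let (z , _ , Vu) = member {t ≐ s} {w ∷ W} vars h u e
          (z′ , _ , Vv) = member {t ≐ s} {w ∷ W} vars h v e′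
      in one-side-true {isVar t} {isVar s} {Z u} {Z v} {freeT u t} {freeT v t} {freeT u s}
           (proj₂ (∧-true {eq-ok (isVar t) (isVar s) (Z v) (freeT v t) (freeT v s)} (proj₂ (∧-true {eq-ok (isVar t) (isVar s) (Z u) (freeT u t) (freeT u s)} (ok Vu Vv))))) vt vs p z q z′
    by-side : ∀ t s → IsTerm t → IsTerm s → (∀ v → v ∈ᵇ (w ∷ W) ≡ true → Side t s v) → Separate t s → Side t s w → t ≐ s ≻ w ∷ W
    by-side (var z) s t✓ s✓ side sep (inj₁ (vt , p , q)) with refl ← ≟-true {z} {w} p =
      resp (only-one (here refl) unique) (eqˡ s✓ (free-∉ s q))
      where
      unique : ∀ v → v ∈ᵇ (w ∷ W) ≡ true → w ≡ v
      unique v e with side v e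
      ... | inj₁ (_ , p′ , _)  = ≟-true p′
      ... | inj₂ (vs , p′ , _) = ⊥-elim (sep w v w∈ e vt vs p p′)
    by-side t (var z) t✓ s✓ side sep (inj₂ (vs , p , q)) with refl ← ≟-true {z} {w} p =
      resp (only-one (here refl) unique) (eqʳ t✓ (free-∉ t q))
      where
      unique : ∀ v → v ∈ᵇ (w ∷ W) ≡ true → w ≡ v
      unique v e with side v e
      ... | inj₂ (_ , p′ , _)  = ≟-true p′
      ... | inj₁ (vt , p′ , _) = ⊥-elim (sep v w e w∈ vt vs p′ p)

  -- Every member of W is the left side itself, so W is a singleton here without any test of mixed
  -- pairs.
  mem-safe : ∀ t s {W Z} → IsTerm t → IsTerm s → VarsIn (write (t ∈̇ s)) → Restricts W Z (t ∈̇ s) →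
    (∀ {x y} → V x → V y → atom-ok ∈ᵒ (Check.kind x y t) (Check.kind x y s) (Z x , Z y) ≡ true) →
    t ∈̇ s ≻ W
  mem-safe t s {[]}    {Z} t✓ s✓ vars h ok = atom-∈ t✓ s✓
  mem-safe t s {w ∷ W} {Z} t✓ s✓ vars h ok = by-side t s s✓ side (side w (∈⇒∈ᵇ {X = w ∷ W} (here refl)))
    where
    Side : PreTerm → PreTerm → Var → Set
    Side t s v = isVar t ≡ true × freeT v t ≡ true × (freeT v s ≡ false ⊎ isVar s ≡ true)
    side : ∀ v → v ∈ᵇ (w ∷ W) ≡ true → Side t s v
    side v e = let (z , f , Vv) = member {t ∈̇ s} {w ∷ W} vars h v e in
      mem-ok-true (isVar t) (isVar s) (proj₁ (∧-true (ok Vv Vv))) z f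
    by-side : ∀ t s → IsTerm s → (∀ v → v ∈ᵇ (w ∷ W) ≡ true → Side t s v) → Side t s w → t ∈̇ s ≻ w ∷ W
    by-side (var z) s s✓ side (_ , p , q) with refl ← ≟-true {z} {w} p =
      resp (only-one (here refl) (λ v e → ≟-true (proj₁ (proj₂ (side v e))))) (membership s s✓ q)
      where
      membership : ∀ s → IsTerm s → freeT w s ≡ false ⊎ isVar s ≡ true → var w ∈̇ s ≻ [ w ]
      membership s       s✓ (inj₁ q) = mem s✓ (free-∉ s q)
      membership (var u) s✓ (inj₂ _) with u ℕᵇ.≟ w
      ... | yes refl = self
      ... | no u≢w   = mem s✓ (λ { (here refl) → u≢w refl })

  term-valid    : ∀ t → VarsIn (writeT t) → (∀ {x y} → V x → V y → Check.okT x y t ≡ true) → IsTerm t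
  formula-valid : ∀ φ → VarsIn (write φ) → (∀ {x y} → V x → V y → Check.okF x y free φ ≡ true) → IsFormula φ
  safe-valid    : ∀ φ Z W → VarsIn (write φ) → Restricts W Z φ →
    (∀ {x y} → V x → V y → Check.okF x y (bound (Z x , Z y)) φ ≡ true) → φ ≻ W

  term-valid (var z)     vars ok = var z
  term-valid (compr z φ) vars ok = compr (≻-formula φ≻z) φ≻z
    where
    vars′ : VarsIn (write φ)
    vars′ p = vars (there (there (there (∈-++⁺ˡ p))))
    binds : ∀ v → does (z ℕᵇ.≟ v) ≡ true → freeF v φ ≡ true
    -- The bound variable is written in the term, so the pair (z , z) has been tested.
    binds v e with refl ← ≟-true {z} {v} e =
      let Vz = vars (there (here refl))
      in ⇒-elim (proj₁ (∧-true (proj₂ (∧-true {Check.okF z z (bound (Check.bit z z z)) φ} (ok Vz Vz))))) (≟-refl z)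
    φ≻z : φ ≻ [ z ]
    φ≻z = safe-valid φ (λ v → does (z ℕᵇ.≟ v)) [ z ] vars′ (λ v → trans (∨-identityʳ _) (restrict (binds v))) (λ p q → proj₁ (∧-true (ok p q)))

  formula-valid (t ≐ s) vars ok =
    eq (term-valid t (λ p → vars (∈-++⁺ˡ p)) (λ p q → proj₁ (∧-true (ok p q))))
       (term-valid s (λ p → vars (∈-++⁺ʳ (writeT t) (there p))) (λ {x} {y} p q → proj₁ (∧-true (proj₂ (∧-true {Check.okT x y t} (ok p q))))))
  formula-valid (t ∈̇ s) vars ok =
    mem (term-valid t (λ p → vars (∈-++⁺ˡ p)) (λ p q → proj₁ (∧-true (ok p q))))
        (term-valid s (λ p → vars (∈-++⁺ʳ (writeT t) (there p))) (λ {x} {y} p q → proj₁ (∧-true (proj₂ (∧-true {Check.okT x y t} (ok p q))))))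
  formula-valid (¬̇ φ) vars ok = neg (formula-valid φ (vars ∘ there) (λ p q → proj₁ (∧-true (ok p q))))
  formula-valid (φ ∧̇ ψ) vars ok =
    and (formula-valid φ (λ p → vars (there (∈-++⁺ˡ p))) (λ p q → proj₁ (∧-true (ok p q))))
        (formula-valid ψ (λ p → vars (there (∈-++⁺ʳ (write φ) (there (∈-++⁺ˡ p)))))
           (λ {x} {y} p q → proj₂ (∧-true {Check.okF x y free φ} (ok p q))))
  formula-valid (φ ∨̇ ψ) vars ok =
    or (formula-valid φ (λ p → vars (there (∈-++⁺ˡ p))) (λ p q → proj₁ (∧-true (ok p q))))
       (formula-valid ψ (λ p → vars (there (∈-++⁺ʳ (write φ) (there (∈-++⁺ˡ p)))))
          (λ {x} {y} p q → proj₁ (∧-true (proj₂ (∧-true {Check.okF x y free φ} (ok p q))))))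
  formula-valid (∃̇ z φ) vars ok = ex (formula-valid φ (vars ∘ there ∘ there) (λ p q → proj₁ (∧-true (ok p q))))

  safe-valid (t ≐ s) Z W vars h ok = eq-safe t s
    (term-valid t (λ p → vars (∈-++⁺ˡ p)) (λ p q → proj₁ (∧-true (ok p q))))
    (term-valid s (λ p → vars (∈-++⁺ʳ (writeT t) (there p))) (λ {x} {y} p q → proj₁ (∧-true (proj₂ (∧-true {Check.okT x y t} (ok p q))))))
    vars h (λ {x} {y} p q → proj₂ (∧-true {Check.okT x y s} (proj₂ (∧-true {Check.okT x y t} (ok p q)))))
  safe-valid (t ∈̇ s) Z W vars h ok = mem-safe t s
    (term-valid t (λ p → vars (∈-++⁺ˡ p)) (λ p q → proj₁ (∧-true (ok p q))))
    (term-valid s (λ p → vars (∈-++⁺ʳ (writeT t) (there p))) (λ {x} {y} p q → proj₁ (∧-true (proj₂ (∧-true {Check.okT x y t} (ok p q))))))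
    vars h (λ {x} {y} p q → proj₂ (∧-true {Check.okT x y s} (proj₂ (∧-true {Check.okT x y t} (ok p q)))))
  safe-valid (¬̇ φ) Z [] vars h ok =
    neg (safe-valid φ (λ _ → false) [] (vars ∘ there) (λ _ → refl) (λ p q → proj₁ (∧-true (ok p q))))
  safe-valid (¬̇ φ) Z (w ∷ W) vars h ok =
    let (z , f , Vw) = member {¬̇ φ} {w ∷ W} vars h w (∈⇒∈ᵇ {X = w ∷ W} (here refl))
    in true≢false (proj₁ (∧-true (proj₂ (∧-true {Check.okF w w (bound none) φ} (ok Vw Vw))))) (cong not (∧-true⁺ z f))
  safe-valid (φ ∧̇ ψ) Z W vars h ok = resp (∈ᵇ-set union)
    (and (safe-valid φ Z X (λ p → vars (there (∈-++⁺ˡ p))) on-φ (λ p q → proj₁ (∧-true (ok p q))))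
         (safe-valid ψ (λ v → Z v ∧ not (freeF v φ)) Y (λ p → vars (there (∈-++⁺ʳ (write φ) (there (∈-++⁺ˡ p))))) on-ψ
            (λ {x} {y} p q → proj₂ (∧-true {Check.okF x y (bound (Z x , Z y)) φ} (ok p q))))
         apart)
    where
    X Y : FinSet
    X = filterᵇ (λ v → freeF v φ) W
    Y = filterᵇ (λ v → not (freeF v φ)) W
    union-bool : ∀ f w → f ∧ w ∨ not f ∧ w ≡ w
    union-bool true  w = ∨-identityʳ w
    union-bool false w = refl
    union : ∀ v → v ∈ᵇ (X ∪ Y) ≡ v ∈ᵇ W
    union v = trans (∈ᵇ-++ v X Y) (trans (cong₂ _∨_ (∈ᵇ-filter _ v W) (∈ᵇ-filter _ v W)) (union-bool (freeF v φ) (v ∈ᵇ W)))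
    left-bool : ∀ f z g → f ∧ (z ∧ (f ∨ g)) ≡ z ∧ f
    left-bool true  z g = refl
    left-bool false z g = sym (∧-zeroʳ z)
    on-φ : Restricts X Z φ
    on-φ v = trans (∈ᵇ-filter _ v W) (trans (cong (freeF v φ ∧_) (h v)) (left-bool (freeF v φ) (Z v) (freeF v ψ)))
    right-bool : ∀ f z g → not f ∧ (z ∧ (f ∨ g)) ≡ (z ∧ not f) ∧ g
    right-bool true  z g = sym (cong (_∧ g) (∧-zeroʳ z))
    right-bool false z g = cong (_∧ g) (sym (∧-identityʳ z))
    on-ψ : Restricts Y (λ v → Z v ∧ not (freeF v φ)) ψ
    on-ψ v = trans (∈ᵇ-filter _ v W) (trans (cong (not (freeF v φ) ∧_) (h v)) (right-bool (freeF v φ) (Z v) (freeF v ψ)))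
    apart : Disjoint Y (Fv φ)
    apart {v} (v∈Y , v∈φ) = true≢false
      (proj₁ (∧-true {not (freeF v φ)} (trans (sym (∈ᵇ-filter _ v W)) (∈⇒∈ᵇ v∈Y))))
      (cong not (trans (freeF-∈ᵇ v φ) (∈⇒∈ᵇ v∈φ)))
  safe-valid (φ ∨̇ ψ) Z W vars h ok =
    or (safe-valid φ Z W vφ on-φ (λ p q → proj₁ (∧-true (ok p q))))
       (safe-valid ψ Z W vψ on-ψ (λ {x} {y} p q → proj₁ (∧-true (proj₂ (∧-true {Check.okF x y (bound (Z x , Z y)) φ} (ok p q))))))
    where
    vφ : VarsIn (write φ)
    vφ p = vars (there (∈-++⁺ˡ p))
    vψ : VarsIn (write ψ)
    vψ p = vars (there (∈-++⁺ʳ (write φ) (there (∈-++⁺ˡ p))))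
    ⇔-true : ∀ {a b} → (a ⇔ᵇ b) ≡ true → a ≡ b
    ⇔-true {true}  {true}  _ = refl
    ⇔-true {false} {false} _ = refl
    agree : ∀ v → Z v ∧ freeF v φ ≡ Z v ∧ freeF v ψ
    -- A variable free in neither disjunct may lie outside `V`, but then both sides are false.
    agree v = by-freeness (freeF v φ) (freeF v ψ) λ e →
      let Vv = vars (free-occursF v (φ ∨̇ ψ) e)
      in ⇔-true (proj₁ (∧-true (proj₂ (∧-true {Check.okF v v (bound (Z v , Z v)) ψ}
           (proj₂ (∧-true {Check.okF v v (bound (Z v , Z v)) φ} (ok Vv Vv)))))))
      where
      by-freeness : ∀ f g → (f ∨ g ≡ true → Z v ∧ f ≡ Z v ∧ g) → Z v ∧ f ≡ Z v ∧ g
      by-freeness true  g     k = k refl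
      by-freeness false true  k = k refl
      by-freeness false false k = refl
    agree-bool : ∀ z f g → z ∧ f ≡ z ∧ g → z ∧ (f ∨ g) ≡ z ∧ f
    agree-bool false f     g     _ = refl
    agree-bool true  true  g     _ = refl
    agree-bool true  false g     e = sym e
    on-φ : Restricts W Z φ
    on-φ v = trans (h v) (agree-bool (Z v) (freeF v φ) (freeF v ψ) (agree v))
    on-ψ : Restricts W Z ψ
    on-ψ v = trans (on-φ v) (agree v)
  -- W cannot contain z, which is not free in `∃̇ z φ`; hence adding z and removing it again gives W
  -- back.
  safe-valid (∃̇ z φ) Z W vars h ok = resp (∈ᵇ-set erased)
    (ex (here refl) (safe-valid φ (λ v → Z v ∨ does (z ℕᵇ.≟ v)) (z ∷ W) (vars ∘ there ∘ there) extended
       (λ p q → proj₁ (∧-true (ok p q)))))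
    where
    binds : ∀ v → does (z ℕᵇ.≟ v) ≡ true → freeF v φ ≡ true
    binds v e with refl ← ≟-true {z} {v} e =
      let Vz = vars (there (here refl))
          d = Z z ∨ does (z ℕᵇ.≟ z)
      in ⇒-elim (proj₁ (∧-true (proj₂ (∧-true {Check.okF z z (bound (d , d)) φ} (ok Vz Vz))))) (≟-refl z)
    extend-bool : ∀ b w z f → w ≡ z ∧ (f ∧ not b) → (b ≡ true → f ≡ true) → b ∨ w ≡ (z ∨ b) ∧ f
    extend-bool true  w z f e k = sym (∧-true⁺ (∨-zeroʳ z) (k refl))
    extend-bool false w z f e k = trans e (cong₂ _∧_ (sym (∨-identityʳ z)) (∧-identityʳ f))
    extended : Restricts (z ∷ W) (λ v → Z v ∨ does (z ℕᵇ.≟ v)) φ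
    extended v = extend-bool (does (z ℕᵇ.≟ v)) (v ∈ᵇ W) (Z v) (freeF v φ) (h v) (binds v)
    erase-bool : ∀ b w z f → w ≡ z ∧ (f ∧ not b) → (b ∨ w) ∧ not b ≡ w
    erase-bool true  w z f e = sym (trans e (trans (cong (z ∧_) (∧-zeroʳ f)) (∧-zeroʳ z)))
    erase-bool false w z f e = ∧-identityʳ w
    erased : ∀ v → v ∈ᵇ ((z ∷ W) ∖ z) ≡ v ∈ᵇ W
    erased v = trans (∈ᵇ-∖ v (z ∷ W) z) (erase-bool (does (z ℕᵇ.≟ v)) (v ∈ᵇ W) (Z v) (freeF v φ) (h v))

-- The three decision procedures

all-true : ∀ {A : Set} (p : A → Bool) xs → all p xs ≡ true → ∀ {x} → x ∈ xs → p x ≡ true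
all-true p (x ∷ xs) e (here refl) = proj₁ (∧-true e)
all-true p (x ∷ xs) e (there x∈)  = all-true p xs (proj₂ (∧-true {p x} e)) x∈

all-true⁺ : ∀ {A : Set} (p : A → Bool) xs → (∀ x → p x ≡ true) → all p xs ≡ true
all-true⁺ p []       h = refl
all-true⁺ p (x ∷ xs) h = ∧-true⁺ (h x) (all-true⁺ p xs h)

reflects : ∀ {P : Set} {b} → (b ≡ true → P) → (P → b ≡ true) → Reflects P b
reflects {b = true}  f g = ofʸ (f refl)
reflects {b = false} f g = ofⁿ (λ p → true≢false (g p) refl)

module Verdict (g : Goal) (E : Expr) (X : FinSet) where

  open Simulation (automaton g) using (machine; machine-answers; accepted; all-accepted)

  toks : List Token
  toks = tokens (E , X)

  Occurs : Var → Set
  Occurs z = just (var z) ∈ toks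

  occurs-E : ∀ {z} → var z ∈ E → Occurs z
  occurs-E p = ∈-++⁺ʳ (map (just ∘ var) X) (there (∈-map⁺ just p))

  occurs-X : ∀ {z} → z ∈ X → Occurs z
  occurs-X p = ∈-++⁺ˡ (∈-map⁺ (just ∘ var) p)

  accepted-names : all-accepted toks ≡ true → ∀ {t u} → t ∈ toks → u ∈ toks → accepted toks (name t) (name u) ≡ true
  accepted-names e {t} p q =
    all-true (λ u → accepted toks (name t) (name u)) toks (all-true (λ t → all (λ u → accepted toks (name t) (name u)) toks) toks e p) q

  -- The separator occurs in every input, so at least one run takes place, even on an expression
  -- without variables; `parse` needs it.
  accepted-zero : all-accepted toks ≡ true → accepted toks (name nothing) (name nothing) ≡ true
  accepted-zero e = accepted-names e hash∈ hash∈
    where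
    hash∈ : nothing ∈ toks
    hash∈ = ∈-++⁺ʳ (map (just ∘ var) X) (here refl)

  accepted-all : (∀ x y → accepted toks x y ≡ true) → all-accepted toks ≡ true
  accepted-all h = all-true⁺ _ toks (λ t → all-true⁺ _ toks (λ u → h (name t) (name u)))

  module _ (x y : Var) where

    open Runs (automaton g) x y

    members : FinSet → Bits
    members Y = x ∈ᵇ Y , y ∈ᵇ Y

    collect : ∀ Y z ts →
      accepts (inj₁ (col z)) [] (map (just ∘ var) Y ++ ts) ≡ accepts (inj₁ (col (z ⊔ members Y))) [] ts
    collect []      z ts = cong₂ (λ a b → accepts (inj₁ (col (a , b))) [] ts) (sym (∨-identityʳ _)) (sym (∨-identityʳ _))
    collect (v ∷ Y) z ts = trans (collect Y (z ⊔ Check.bit x y v) ts)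
      (cong₂ (λ a b → accepts (inj₁ (col (a , b))) [] ts) (∨-assoc (proj₁ z) _ _) (∨-assoc (proj₂ z) _ _))

    accepted-collected : accepted toks x y ≡ accepts (inj₁ (col (members X))) [] (nothing ∷ map just E)
    accepted-collected = collect X none _

    accepts-whole-term : ∀ t → accepts (inj₁ expT) (goalT ∷ []) (map just (writeT t)) ≡ Check.okT x y t
    accepts-whole-term t = begin
      accepts (inj₁ expT) (goalT ∷ []) (map just (writeT t))       ≡⟨ cong (accepts (inj₁ expT) (goalT ∷ [])) (++-identityʳ (map just (writeT t))) ⟨
      accepts (inj₁ expT) (goalT ∷ []) (map just (writeT t) ++ []) ≡⟨ Check.accepts-term x y g t _ [] ⟩
      Check.okT x y t ∧ true                                       ≡⟨ ∧-identityʳ _ ⟩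
      Check.okT x y t                                              ∎
      where open ≡-Reasoning

    accepts-whole-formula : ∀ φ i z → accepts (inj₁ (expF i)) (goalF z ∷ []) (map just (write φ)) ≡
      Check.okF x y i φ ∧ bind-ok z (Check.fvF x y φ)
    accepts-whole-formula φ i z = begin
      accepts (inj₁ (expF i)) (goalF z ∷ []) (map just (write φ))
        ≡⟨ cong (accepts (inj₁ (expF i)) (goalF z ∷ [])) (++-identityʳ (map just (write φ))) ⟨
      accepts (inj₁ (expF i)) (goalF z ∷ []) (map just (write φ) ++ [])
        ≡⟨ Check.accepts-formula x y g φ i _ [] ⟩
      Check.okF x y i φ ∧ reduce (guard (bind-ok z (Check.fvF x y φ)) (inj₁ end)) [] []
        ≡⟨ cong (Check.okF x y i φ ∧_) (trans (Check.guard-accepts x y g (bind-ok z (Check.fvF x y φ)) (inj₁ end) [] []) (∧-identityʳ _)) ⟩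
      Check.okF x y i φ ∧ bind-ok z (Check.fvF x y φ) ∎
      where open ≡-Reasoning

decides : ∀ {P : Input → Set} g → (∀ i → Simulation.all-accepted (automaton g) (tokens i) ≡ true → P i) →
  (∀ i → P i → Simulation.all-accepted (automaton g) (tokens i) ≡ true) → PolyTimeDecidable P
decides g sound complete = machine , 24 , 3 , λ i →
  all-accepted (tokens i) , machine-answers i , reflects (sound i) (complete i)
  where open Simulation (automaton g)

-- One run supplies the tree. With E replaced by the text of that tree, the runs for all pairs of
-- occurring names become tests of this same tree.
term-sound : ∀ E X → Simulation.all-accepted (automaton term) (tokens (E , X)) ≡ true → ValidTerm E
term-sound E X e with Check.parse v₀ v₀ term (inj₁ expT) (goalT ∷ []) E
                        (trans (sym (accepted-collected v₀ v₀)) (accepted-zero e))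
  where
  open Verdict term E X
  v₀ = name nothing
... | t , _ , refl , refl rewrite ++-identityʳ (writeT t) = t , refl ,
  Complete.term-valid Occurs t occurs-E λ {x} {y} p q →
    trans (sym (accepts-whole-term x y t)) (trans (sym (accepted-collected x y)) (accepted-names e p q))
  where open Verdict term (writeT t) X

term-complete : ∀ E X → ValidTerm E → Simulation.all-accepted (automaton term) (tokens (E , X)) ≡ true
term-complete _ X (t , refl , t✓) = accepted-all λ x y →
  trans (accepted-collected x y) (trans (accepts-whole-term x y t) (term-ok t✓ x y))
  where open Verdict term (writeT t) X

formula-sound : ∀ E X → Simulation.all-accepted (automaton formula) (tokens (E , X)) ≡ true → ValidFormula E
formula-sound E X e with Check.parse v₀ v₀ formula (inj₁ (expF free)) (goalF none ∷ []) E
                           (trans (sym (accepted-collected v₀ v₀)) (accepted-zero e))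
  where
  open Verdict formula E X
  v₀ = name nothing
... | φ , _ , refl , refl rewrite ++-identityʳ (write φ) = φ , refl ,
  Complete.formula-valid Occurs φ occurs-E λ {x} {y} p q →
    trans (sym (∧-identityʳ _)) (trans (sym (accepts-whole-formula x y φ free none))
      (trans (sym (accepted-collected x y)) (accepted-names e p q)))
  where open Verdict formula (write φ) X

formula-complete : ∀ E X → ValidFormula E → Simulation.all-accepted (automaton formula) (tokens (E , X)) ≡ true
formula-complete _ X (φ , refl , φ✓) = accepted-all λ x y →
  trans (accepted-collected x y) (trans (accepts-whole-formula x y φ free none) (∧-true⁺ (formula-ok φ✓ x y) refl))
  where open Verdict formula (write φ) X

safe-sound : ∀ E X → Simulation.all-accepted (automaton safe) (tokens (E , X)) ≡ true → Safe E X
safe-sound E X e with Check.parse v₀ v₀ safe (inj₁ (expF (bound z))) (goalF z ∷ []) E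
                        (trans (sym (accepted-collected v₀ v₀)) (accepted-zero e))
  where
  open Verdict safe E X
  v₀ = name nothing
  z = members v₀ v₀ X
... | φ , _ , refl , refl rewrite ++-identityʳ (write φ) = φ , refl , ≻-formula φ≻X , φ≻X
  where
  open Verdict safe (write φ) X
  ok : ∀ {x y} → Occurs x → Occurs y →
    Check.okF x y (bound (members x y X)) φ ∧ bind-ok (members x y X) (Check.fvF x y φ) ≡ true
  ok {x} {y} p q = trans (sym (accepts-whole-formula x y φ (bound (members x y X)) (members x y X)))
    (trans (sym (accepted-collected x y)) (accepted-names e p q))
  -- This comes from the check at the bottom frame. It makes X its own restriction to the free
  -- variables, as `safe-valid` requires.
  X⊆Fv : ∀ v → v ∈ᵇ X ≡ true → freeF v φ ≡ true
  X⊆Fv v v∈ = let Ov = occurs-X (∈ᵇ⇒∈ X v∈) in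
    ⇒-elim (proj₁ (∧-true (proj₂ (∧-true {Check.okF v v (bound (members v v X)) φ} (ok Ov Ov))))) v∈
  φ≻X : φ ≻ X
  φ≻X = Complete.safe-valid Occurs φ (_∈ᵇ X) X occurs-E (λ v → restrict (X⊆Fv v)) (λ p q → proj₁ (∧-true (ok p q)))

safe-complete : ∀ E X → Safe E X → Simulation.all-accepted (automaton safe) (tokens (E , X)) ≡ true
safe-complete _ X (φ , refl , _ , p) = accepted-all λ x y →
  trans (accepted-collected x y) (trans (accepts-whole-formula x y φ (bound (members x y X)) (members x y X))
    (∧-true⁺ (safe-ok p (_∈ᵇ X) (λ v → restrict (≻-free p v)) x y)
             (∧-true⁺ (⇒-intro _ _ (≻-free p x)) (⇒-intro _ _ (≻-free p y)))))
  where open Verdict safe (write φ) X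

theorem1 : PolyTimeDecidable (λ (E , X) → ValidTerm E) ×
    PolyTimeDecidable (λ (E , X) → ValidFormula E) ×
    PolyTimeDecidable (λ (E , X) → Safe E X)
theorem1 = decides term (λ (E , X) → term-sound E X) (λ (E , X) → term-complete E X)
         , decides formula (λ (E , X) → formula-sound E X) (λ (E , X) → formula-complete E X)
         , decides safe (λ (E , X) → safe-sound E X) (λ (E , X) → safe-complete E X)
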